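{- Let $\mathcal{U}_0=\{\mathbb{I}\}$ and, for $d\ge 1$, $\mathcal{U}_d=B_+(\mathcal{U}_{d-1})\cup \bullet\,\mathcal{U}_{d-1}$, where $B_+(X)=\{B_+(f)\mid f\in X\}$ and $\bullet\,X=\{\bullet\, f\mid f\in X\}$ for $X\subset\mathcal{H}$. Then the set $\rho\left(\bigsqcup_{d\ge 0}\mathcal{U}_d\right)$ forms a basis of the $\mathbb{Q}$-vector space $\widetilde{\mathcal{H}}=\operatorname{Im}\rho$ of rooted tree maps.
   Context: A rooted tree is a finite connected oriented simple graph with exactly one distinguished vertex (the root) having no incoming edges; trees are non-planar (branches unordered) and considered up to isomorphism. A rooted forest is a finite (commutative) product, i.e. disjoint union, of rooted trees; the empty forest is denoted $\mathbb{I}$. Let $\bullet$ denote the one-vertex tree. $\mathcal{H}$ is the free commutative unital $\mathbb{Q}$-algebra generated by the rooted trees (so forests form a $\mathbb{Q}$-basis of $\mathcal{H}$). The grafting operator $B_+$ is the $\mathbb{Q}$-linear map sending $\mathbb{I}$ to $\bullet$ and a forest $t_1\cdots t_n$ to the tree obtained by joining the roots of $t_1,\dots,t_n$ to a new common root. Every tree $t$ equals $B_+(f)$ for a unique forest $f$. The coproduct $\Delta:\mathcal{H}\to\mathcal{H}\otimes\mathcal{H}$ is the algebra homomorphism with $\Delta(\mathbb{I})=\mathbb{I}\otimes\mathbb{I}$ and, for a tree $t=B_+(f)$, $\Delta(t)=t\otimes\mathbb{I}+((\mathrm{id}\otimes B_+)\circ\Delta)(f)$. Let $\mathfrak{H}=\mathbb{Q}\langle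 x,y\rangle$ (noncommutative polynomials). For $w\in\mathfrak{H}$, $R_w$ is right multiplication by $w$, and $R_y^{ -1}$ removes a final letter $y$ (defined on $\mathfrak{H}y$). Rooted tree maps: $\tilde{\mathbb{I}}=\mathrm{id}$, and for a nonempty forest $f$, $\tilde f:\mathfrak{H}\to\mathfrak{H}$ is the $\mathbb{Q}$-linear map determined by: (I) $\tilde\bullet(x)=-\tilde\bullet(y)=xy$; (II) $\widetilde{B_+(f)}(x)=-\widetilde{B_+(f)}(y)=R_yR_{x+2y}R_y^{ -1}\tilde f(x)$; (III) if $f=gh$ with forests $g,h$, then $\tilde f(v)=\tilde g(\tilde h(v))$ for $v\in\{x,y\}$; (IV) $\tilde f(wv)=\sum_{(f)}\tilde f_1(w)\tilde f_2(v)$ for $w\in\mathfrak{H}$, $v\in\{x,y\}$, where $\Delta(f)=\sum_{(f)} f_1\otimes f_2$; also $\tilde f(1)=0$ for nonempty $f$ (constants are killed by maps from elements with no degree-0 part), and the assignment is extended linearly to all of $\mathcal{H}$. Define $\rho:\mathcal{H}\to\mathrm{End}(\mathfrak{H})$ by $\rho(f)=\tilde f$; it is an algebra homomorphism, and $\widetilde{\mathcal{H}}=\operatorname{Im}\rho$. -}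

module Defs where

open import Data.Rational using (ℚ; 0ℚ; 1ℚ; _+_; _*_; -_)
open import Data.List using (List; []; _∷_; _++_; map; foldr; concatMap)
open import Data.List.Properties using (≡-dec)
open import Data.List.Relation.Unary.All using (All)
open import Data.List.Relation.Unary.AllPairs using (AllPairs)
open import Data.Product using (_×_; _,_; proj₁; proj₂; ∃)
open import Relation.Binary.PropositionalEquality using (_≡_; refl)
open import Relation.Nullary using (¬_; yes; no; Dec)

-- Rooted trees and forests (planar representatives; a forest of H is
-- represented by a list of trees, the empty list being 𝕀).

data Tree : Set where
  node : List Tree → Tree

Forest : Set
Forest = List Tree

B₊ : Forest → Tree
B₊ f = node f

• : Tree
• = node []

H : Set
H = List (ℚ × Forest)

-- Coproduct Δ (Connes–Kreimer), as a list of terms f₁ ⊗ f₂ (with repetition).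
mutual
  ΔT : Tree → List (Forest × Forest)
  ΔT (node f) = (node f ∷ [] , []) ∷ graftR (ΔF f)

  ΔF : Forest → List (Forest × Forest)
  ΔF []      = ([] , []) ∷ []
  ΔF (t ∷ f) = mulΔ (ΔT t) (ΔF f)

  graftR : List (Forest × Forest) → List (Forest × Forest)
  graftR = map (λ p → (proj₁ p , node (proj₂ p) ∷ []))

  mulΔ : List (Forest × Forest) → List (Forest × Forest) → List (Forest × Forest)
  mulΔ xs ys = concatMap (λ a → map (λ b → (proj₁ a ++ proj₁ b , proj₂ a ++ proj₂ b)) ys) xs

-- 𝔥 = ℚ⟨x,y⟩ : noncommutative polynomials, as finite lists of
-- (coefficient , word), with equality = equality of all coefficients.

data Letter : Set where
  x y : Letter

_≟L_ : (a b : Letter) → Dec (a ≡ b)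
x ≟L x = yes refl
x ≟L y = no λ ()
y ≟L x = no λ ()
y ≟L y = yes refl

Word : Set
Word = List Letter

_≟W_ : (u v : Word) → Dec (u ≡ v)
_≟W_ = ≡-dec _≟L_

Poly : Set
Poly = List (ℚ × Word)

coeff : Poly → Word → ℚ
coeff []            w = 0ℚ
coeff ((c , u) ∷ p) w with u ≟W w
... | yes _ = c + coeff p w
... | no  _ = coeff p w

infix 4 _≈_
_≈_ : Poly → Poly → Set
p ≈ q = ∀ w → coeff p w ≡ coeff q w

zeroP : Poly
zeroP = []

mono : Word → Poly
mono w = (1ℚ , w) ∷ []

_⊕_ : Poly → Poly → Poly
p ⊕ q = p ++ q

scale : ℚ → Poly → Poly
scale c = map (λ m → (c * proj₁ m , proj₂ m))

negP : Poly → Poly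
negP = scale (- 1ℚ)

_⊗_ : Poly → Poly → Poly
p ⊗ q = concatMap (λ a → map (λ b → (proj₁ a * proj₁ b , proj₂ a ++ proj₂ b)) q) p

x+2y : Poly
x+2y = (1ℚ , x ∷ []) ∷ (1ℚ + 1ℚ , y ∷ []) ∷ []

sumP : List Poly → Poly
sumP = foldr _⊕_ zeroP

-- A candidate assignment ρ(f) is given by its values on words; it is
-- extended ℚ-linearly to 𝔥 (so each ρ(f) is automatically linear).

Assign : Set
Assign = Forest → Word → Poly

lin : Assign → Forest → Poly → Poly
lin ρ f p = sumP (map (λ m → scale (proj₁ m) (ρ f (proj₂ m))) p)

ρH : Assign → H → Word → Poly
ρH ρ h w = sumP (map (λ a → scale (proj₁ a) (ρ (proj₂ a) w)) h)

record IsRootedTreeMap (ρ : Assign) : Set where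
  field
    unit   : ∀ w → ρ [] w ≈ mono w
    const  : ∀ t f → ρ (t ∷ f) [] ≈ zeroP
    ruleIx : ρ (• ∷ []) (x ∷ []) ≈ mono (x ∷ y ∷ [])
    ruleIy : ρ (• ∷ []) (y ∷ []) ≈ negP (mono (x ∷ y ∷ []))
    -- (II) for nonempty f: f~(x) ∈ 𝔥y, and B₊(f)~(x) = - B₊(f)~(y) = R_y R_{x+2y} R_y⁻¹ f~(x)
    ruleII : ∀ t g → ∃ λ (q : Poly) →
               (ρ (t ∷ g) (x ∷ []) ≈ q ⊗ mono (y ∷ []))
             × (ρ (B₊ (t ∷ g) ∷ []) (x ∷ []) ≈ (q ⊗ x+2y) ⊗ mono (y ∷ []))
             × (ρ (B₊ (t ∷ g) ∷ []) (y ∷ []) ≈ negP ((q ⊗ x+2y) ⊗ mono (y ∷ [])))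
    ruleIII : ∀ g h (v : Letter) → ρ (g ++ h) (v ∷ []) ≈ lin ρ g (ρ h (v ∷ []))
    ruleIV : ∀ f (w : Word) (v : Letter) →
               ρ f (w ++ v ∷ []) ≈ sumP (map (λ p → ρ (proj₁ p) w ⊗ ρ (proj₂ p) (v ∷ [])) (ΔF f))

data InU : Forest → Set where
  u-nil  : InU []
  u-B₊   : ∀ {f} → InU f → InU (B₊ f ∷ [])
  u-dot  : ∀ {f} → InU f → InU (• ∷ f)

-- equality of maps 𝔥 → 𝔥 (checked on the word basis)
_≐_ : (Word → Poly) → (Word → Poly) → Set
φ ≐ ψ = ∀ w → φ w ≈ ψ w

Spans : Assign → Set
Spans ρ = ∀ (h : H) → ∃ λ (us : H) →
            All (λ a → InU (proj₂ a)) us × (ρH ρ h ≐ ρH ρ us)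

-- ρ(⊔𝒰_d) is linearly independent (as a set of maps: the chosen
-- elements have pairwise distinct images)
Independent : Assign → Set
Independent ρ = ∀ (us : H) →
                  All (λ a → InU (proj₂ a)) us →
                  AllPairs (λ a b → ¬ (ρ (proj₂ a) ≐ ρ (proj₂ b))) us →
                  ρH ρ us ≐ (λ _ → zeroP) →
                  All (λ a → proj₁ a ≡ 0ℚ) us

{-# OPTIONS --safe #-}

-- In the letters z = x + y and y every rooted tree map commutes with right
-- multiplication by z, and the map of B₊ f is obtained from that of f by a
-- recursion on the last letter.  Taking this recursion as the definition of an
-- operation A ↦ graft A on operators gives a model T satisfying rules (I)-(IV).
-- Spanning: writing A⁺ = graft A and E = graft id, the recursion yields
--   A⁺ B⁺ = (A⁺ B)⁺ + (A B⁺)⁺ + E (A B)⁺ - (E A B)⁺ - (A B)⁺⁺ ,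
-- so E commutes with all T f and the span of T u, u ∈ U, is closed under products.
-- Independence: on the letter y, B₊ acts as right multiplication by z + y and •
-- as E °.  A kernel element of the two together gives a series Q with
-- 2n Q = n E(Q_z) - E(Q_y y) y⁻¹ for n = 1, and such a solution for n gives one for
-- 2n + 1 of lower degree, hence vanishes.
module Submission where

open import Defs
open import Data.Bool using (if_then_else_)
open import Data.List using (List; []; _∷_; _++_; map; concatMap; reverse; length)
open import Data.List.Membership.Propositional using (_∈_)
open import Data.List.Properties using (unfold-reverse; reverse-++; reverse-involutive)
open import Data.List.Relation.Unary.All using (All; []; _∷_)
import Data.List.Relation.Unary.All as All
open import Data.List.Relation.Unary.All.Properties using (++⁺; map⁺; concat⁺)
open import Data.List.Relation.Unary.AllPairs using (AllPairs; []; _∷_)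
import Data.List.Relation.Unary.AllPairs as AllPairs
open import Data.List.Relation.Unary.Any using (here; there)
open import Data.Maybe.Base using (just; nothing)
open import Data.Nat using (ℕ; zero; suc; s≤s; z≤n) renaming (_+_ to _+ᴺ_; _≤_ to _≤ᴺ_)
import Data.Nat.Properties as ℕ
open import Data.Product using (_×_; _,_; proj₁; proj₂; ∃)
open import Data.Rational using (ℚ; 0ℚ; 1ℚ; _+_; _*_; -_; 1/_; Positive)
open import Data.Rational.Properties using (_≟_; +-*-commutativeRing; +-identityʳ; *-zeroʳ; *-zeroˡ; *-identityˡ; *-assoc; *-inverseˡ; pos⇒nonZero; pos+pos⇒pos)
open import Function using (_∘_; id)
open import Level using (0ℓ)
open import Relation.Binary.PropositionalEquality using (_≡_; _≢_; refl; sym; trans; cong; cong₂; subst; _≗_; module ≡-Reasoning)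
open import Relation.Nullary using (yes; no; does; contradiction)
open import Tactic.RingSolver using (solve-∀)
open import Tactic.RingSolver.Core.AlmostCommutativeRing using (AlmostCommutativeRing; fromCommutativeRing)

-- Rational arithmetic and finite sums.

ℚ-ring : AlmostCommutativeRing 0ℓ 0ℓ
ℚ-ring = fromCommutativeRing +-*-commutativeRing λ q → 0≟ q
  where
  0≟ : ∀ q → _
  0≟ q with 0ℚ ≟ q
  ... | yes 0≡q = just 0≡q
  ... | no  _   = nothing

-2ℚ : ℚ
-2ℚ = - (1ℚ + 1ℚ)

∑ : ∀ {I : Set} → List I → (I → ℚ) → ℚ
∑ []       f = 0ℚ
∑ (i ∷ is) f = f i + ∑ is f

∑-cong : ∀ {I : Set} (is : List I) {f g : I → ℚ} → f ≗ g → ∑ is f ≡ ∑ is g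
∑-cong []       e = refl
∑-cong (i ∷ is) e = cong₂ _+_ (e i) (∑-cong is e)

∑-+ : ∀ {I : Set} (is : List I) (f g : I → ℚ) → ∑ is (λ i → f i + g i) ≡ ∑ is f + ∑ is g
∑-+ []       f g = refl
∑-+ (i ∷ is) f g = trans (cong (f i + g i +_) (∑-+ is f g)) (arith (f i) (g i) _ _)
  where
  arith : ∀ a b c d → a + b + (c + d) ≡ a + c + (b + d)
  arith = solve-∀ ℚ-ring

∑-* : ∀ {I : Set} (is : List I) c (f : I → ℚ) → ∑ is (λ i → c * f i) ≡ c * ∑ is f
∑-* []       c f = sym (*-zeroʳ c)
∑-* (i ∷ is) c f = trans (cong (c * f i +_) (∑-* is c f)) (arith c (f i) _)
  where
  arith : ∀ c a b → c * a + c * b ≡ c * (a + b)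
  arith = solve-∀ ℚ-ring

∑-0 : ∀ {I : Set} (is : List I) → ∑ is (λ _ → 0ℚ) ≡ 0ℚ
∑-0 []       = refl
∑-0 (i ∷ is) = trans (cong (0ℚ +_) (∑-0 is)) refl

∑-++ : ∀ {I : Set} (is js : List I) (f : I → ℚ) → ∑ (is ++ js) f ≡ ∑ is f + ∑ js f
∑-++ []       js f = arith (∑ js f)
  where
  arith : ∀ a → a ≡ 0ℚ + a
  arith = solve-∀ ℚ-ring
∑-++ (i ∷ is) js f = trans (cong (f i +_) (∑-++ is js f)) (arith (f i) _ _)
  where
  arith : ∀ a b c → a + (b + c) ≡ a + b + c
  arith = solve-∀ ℚ-ring

∑-map : ∀ {I J : Set} (h : I → J) (is : List I) (f : J → ℚ) → ∑ (map h is) f ≡ ∑ is (f ∘ h)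
∑-map h []       f = refl
∑-map h (i ∷ is) f = cong (f (h i) +_) (∑-map h is f)

∑-concatMap : ∀ {I J : Set} (h : I → List J) (is : List I) (f : J → ℚ) →
              ∑ (concatMap h is) f ≡ ∑ is (λ i → ∑ (h i) f)
∑-concatMap h []       f = refl
∑-concatMap h (i ∷ is) f = trans (∑-++ (h i) (concatMap h is) f) (cong (∑ (h i) f +_) (∑-concatMap h is f))

-- Series in z and y and their basic operations.

-- Noncommutative power series in z = x + y and y; words are read from the
-- right, so that the head of the list is the last letter.
data Letterᶻ : Set where
  z y : Letterᶻ

Series : Set
Series = List Letterᶻ → ℚ

infixl 6 _⊞_
infixl 7 _⊡_ _⊛_

𝟘 𝟙 : Series
𝟘 _       = 0ℚ
𝟙 []      = 1ℚ
𝟙 (_ ∷ _) = 0ℚ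

_⊞_ : Series → Series → Series
(S ⊞ S′) u = S u + S′ u

_⊡_ : ℚ → Series → Series
(c ⊡ S) u = c * S u

∂ : Letterᶻ → Series → Series
∂ l S u = S (l ∷ u)

Rz Ry : Series → Series
Rz S []      = 0ℚ
Rz S (z ∷ u) = S u
Rz S (y ∷ u) = 0ℚ
Ry S []      = 0ℚ
Ry S (z ∷ u) = 0ℚ
Ry S (y ∷ u) = S u

-- The Cauchy product. Splitting off last letters, V = V(0) + V_z z + V_y y gives S V = V(0) S + (S
-- V_z) z + (S V_y) y, which is the recursion below.
_⊛_ : Series → Series → Series
(S ⊛ V) []      = S [] * V []
(S ⊛ V) (l ∷ u) = (S ⊛ ∂ l V) u + V [] * S (l ∷ u)

Rz-cong : ∀ {S S′} → S ≗ S′ → Rz S ≗ Rz S′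
Rz-cong e []      = refl
Rz-cong e (z ∷ u) = e u
Rz-cong e (y ∷ u) = refl

Ry-cong : ∀ {S S′} → S ≗ S′ → Ry S ≗ Ry S′
Ry-cong e []      = refl
Ry-cong e (z ∷ u) = refl
Ry-cong e (y ∷ u) = e u

Rz-𝟘 : Rz 𝟘 ≗ 𝟘
Rz-𝟘 []      = refl
Rz-𝟘 (z ∷ u) = refl
Rz-𝟘 (y ∷ u) = refl

Ry-𝟘 : Ry 𝟘 ≗ 𝟘
Ry-𝟘 []      = refl
Ry-𝟘 (z ∷ u) = refl
Ry-𝟘 (y ∷ u) = refl

Rz-⊞ : ∀ S S′ → Rz (S ⊞ S′) ≗ Rz S ⊞ Rz S′
Rz-⊞ S S′ []      = refl
Rz-⊞ S S′ (z ∷ u) = refl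
Rz-⊞ S S′ (y ∷ u) = refl

Ry-⊞ : ∀ S S′ → Ry (S ⊞ S′) ≗ Ry S ⊞ Ry S′
Ry-⊞ S S′ []      = refl
Ry-⊞ S S′ (z ∷ u) = refl
Ry-⊞ S S′ (y ∷ u) = refl

Rz-⊡ : ∀ c S → Rz (c ⊡ S) ≗ c ⊡ Rz S
Rz-⊡ c S []      = sym (*-zeroʳ c)
Rz-⊡ c S (z ∷ u) = refl
Rz-⊡ c S (y ∷ u) = sym (*-zeroʳ c)

Ry-⊡ : ∀ c S → Ry (c ⊡ S) ≗ c ⊡ Ry S
Ry-⊡ c S []      = sym (*-zeroʳ c)
Ry-⊡ c S (z ∷ u) = sym (*-zeroʳ c)
Ry-⊡ c S (y ∷ u) = refl

-- Operators on series and the recursion for B₊.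

Operator : Set
Operator = Series → Series

infix 9 _°
_° : Operator → Operator
(A °) S = ∂ y (A (Ry S))

-- Series are functions compared pointwise, hence the field `≗-cong`. By `Ry-stable` the image of S
-- y is again a right multiple of y, so that `A °` loses no information about it.
record IsOp (A : Operator) : Set where
  field
    ≗-cong : ∀ {S S′} → S ≗ S′ → A S ≗ A S′
    ⊞-homo : ∀ S S′ → A (S ⊞ S′) ≗ A S ⊞ A S′
    ⊡-homo : ∀ c S → A (c ⊡ S) ≗ c ⊡ A S
    Rz-comm : ∀ S → A (Rz S) ≗ Rz (A S)
    Ry-stable : ∀ S → A (Ry S) ≗ Ry ((A °) S)

  𝟘-homo : A 𝟘 ≗ 𝟘
  𝟘-homo u = trans (≗-cong (λ _ → refl) u) (trans (⊡-homo 0ℚ 𝟘 u) (*-zeroˡ (A 𝟘 u)))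

  °-cong : ∀ {S S′} → S ≗ S′ → (A °) S ≗ (A °) S′
  °-cong e u = ≗-cong (Ry-cong e) (y ∷ u)

  °-⊞ : ∀ S S′ → (A °) (S ⊞ S′) ≗ (A °) S ⊞ (A °) S′
  °-⊞ S S′ u = trans (≗-cong (Ry-⊞ S S′) (y ∷ u)) (⊞-homo _ _ (y ∷ u))

  °-⊡ : ∀ c S → (A °) (c ⊡ S) ≗ c ⊡ (A °) S
  °-⊡ c S u = trans (≗-cong (Ry-⊡ c S) (y ∷ u)) (⊡-homo c _ (y ∷ u))

  ∑-homo : ∀ {I : Set} (is : List I) (F : I → Series) →
           A (λ u → ∑ is (λ i → F i u)) ≗ λ u → ∑ is (λ i → A (F i) u)
  ∑-homo []       F u = 𝟘-homo u
  ∑-homo (i ∷ is) F u = trans (⊞-homo (F i) _ u) (cong (A (F i) u +_) (∑-homo is F u))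


open IsOp

-- If A is the operator of f, then graft A is that of B₊ f: rules (II) and (IV)
-- amount to graft A (S y) = (graft A S + growth A S) y, and A (S y) = (A ° S) y.
growth : Operator → Operator
growth A S = (Rz ((A °) S) ⊞ Ry ((A °) S)) ⊞ -2ℚ ⊡ Rz (A S)

graft : Operator → Operator
graft A S []      = 0ℚ
graft A S (z ∷ u) = graft A (∂ z S) u
graft A S (y ∷ u) = graft A (∂ y S) u + growth A (∂ y S) u

growth-cong : ∀ {A} → IsOp A → ∀ {S S′} → S ≗ S′ → growth A S ≗ growth A S′
growth-cong o e u =
  cong₂ _+_ (cong₂ _+_ (Rz-cong (°-cong o e) u) (Ry-cong (°-cong o e) u))
            (cong (-2ℚ *_) (Rz-cong (≗-cong o e) u))

growth-⊞ : ∀ {A} → IsOp A → ∀ S S′ → growth A (S ⊞ S′) ≗ growth A S ⊞ growth A S′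
growth-⊞ {A} o S S′ u = trans
  (cong₂ _+_ (cong₂ _+_ (trans (Rz-cong (°-⊞ o S S′) u) (Rz-⊞ _ _ u))
                        (trans (Ry-cong (°-⊞ o S S′) u) (Ry-⊞ _ _ u)))
             (cong (-2ℚ *_) (trans (Rz-cong (⊞-homo o S S′) u) (Rz-⊞ _ _ u))))
  (arith (Rz ((A °) S) u) _ (Ry ((A °) S) u) _ -2ℚ (Rz (A S) u) _)
  where
  arith : ∀ a a′ b b′ k c c′ → a + a′ + (b + b′) + k * (c + c′) ≡ a + b + k * c + (a′ + b′ + k * c′)
  arith = solve-∀ ℚ-ring

growth-⊡ : ∀ {A} → IsOp A → ∀ c S → growth A (c ⊡ S) ≗ c ⊡ growth A S
growth-⊡ {A} o c S u = trans
  (cong₂ _+_ (cong₂ _+_ (trans (Rz-cong (°-⊡ o c S) u) (Rz-⊡ c _ u))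
                        (trans (Ry-cong (°-⊡ o c S) u) (Ry-⊡ c _ u)))
             (cong (-2ℚ *_) (trans (Rz-cong (⊡-homo o c S) u) (Rz-⊡ c _ u))))
  (arith c (Rz ((A °) S) u) (Ry ((A °) S) u) -2ℚ (Rz (A S) u))
  where
  arith : ∀ c a b k d → c * a + c * b + k * (c * d) ≡ c * (a + b + k * d)
  arith = solve-∀ ℚ-ring

growth-𝟘 : ∀ {A} → IsOp A → growth A 𝟘 ≗ 𝟘
growth-𝟘 {A} o u = trans (growth-cong o (λ _ → refl) u) (trans (growth-⊡ o 0ℚ 𝟘 u) (*-zeroˡ (growth A 𝟘 u)))

module _ {A : Operator} (o : IsOp A) where

  graft-cong : ∀ {S S′} → S ≗ S′ → graft A S ≗ graft A S′
  graft-cong e []      = refl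
  graft-cong e (z ∷ u) = graft-cong (e ∘ (z ∷_)) u
  graft-cong e (y ∷ u) = cong₂ _+_ (graft-cong (e ∘ (y ∷_)) u) (growth-cong o (e ∘ (y ∷_)) u)

  graft-⊞ : ∀ S S′ → graft A (S ⊞ S′) ≗ graft A S ⊞ graft A S′
  graft-⊞ S S′ []      = refl
  graft-⊞ S S′ (z ∷ u) = graft-⊞ (∂ z S) (∂ z S′) u
  graft-⊞ S S′ (y ∷ u) = trans
    (cong₂ _+_ (graft-⊞ (∂ y S) (∂ y S′) u) (growth-⊞ o (∂ y S) (∂ y S′) u))
    (arith (graft A (∂ y S) u) _ (growth A (∂ y S) u) _)
    where
    arith : ∀ a b c d → a + b + (c + d) ≡ a + c + (b + d)
    arith = solve-∀ ℚ-ring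

  graft-⊡ : ∀ c S → graft A (c ⊡ S) ≗ c ⊡ graft A S
  graft-⊡ c S []      = sym (*-zeroʳ c)
  graft-⊡ c S (z ∷ u) = graft-⊡ c (∂ z S) u
  graft-⊡ c S (y ∷ u) = trans
    (cong₂ _+_ (graft-⊡ c (∂ y S) u) (growth-⊡ o c (∂ y S) u))
    (arith c (graft A (∂ y S) u) (growth A (∂ y S) u))
    where
    arith : ∀ c a b → c * a + c * b ≡ c * (a + b)
    arith = solve-∀ ℚ-ring

  graft-𝟘 : graft A 𝟘 ≗ 𝟘
  graft-𝟘 []      = refl
  graft-𝟘 (z ∷ u) = graft-𝟘 u
  graft-𝟘 (y ∷ u) = trans (cong₂ _+_ (graft-𝟘 u) (growth-𝟘 o u)) refl

  graft-Rz : ∀ S → graft A (Rz S) ≗ Rz (graft A S)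
  graft-Rz S []      = refl
  graft-Rz S (z ∷ u) = refl
  graft-Rz S (y ∷ u) = graft-𝟘 (y ∷ u)

  graft-Ry : ∀ S → graft A (Ry S) ≗ Ry ((graft A °) S)
  graft-Ry S []      = refl
  graft-Ry S (z ∷ u) = graft-𝟘 u
  graft-Ry S (y ∷ u) = refl

  graft-isOp : IsOp (graft A)
  graft-isOp = record
    { ≗-cong = graft-cong ; ⊞-homo = graft-⊞ ; ⊡-homo = graft-⊡
    ; Rz-comm = graft-Rz ; Ry-stable = graft-Ry }

id-isOp : IsOp id
id-isOp = record
  { ≗-cong = λ e → e ; ⊞-homo = λ _ _ _ → refl ; ⊡-homo = λ _ _ _ → refl
  ; Rz-comm = λ _ _ → refl ; Ry-stable = λ { S [] → refl ; S (z ∷ u) → refl ; S (y ∷ u) → refl } }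

∘-isOp : ∀ {A B} → IsOp A → IsOp B → IsOp (A ∘ B)
∘-isOp {A} {B} oA oB = record
  { ≗-cong = λ e → ≗-cong oA (≗-cong oB e)
  ; ⊞-homo = λ S S′ u → trans (≗-cong oA (⊞-homo oB S S′) u) (⊞-homo oA _ _ u)
  ; ⊡-homo = λ c S u → trans (≗-cong oA (⊡-homo oB c S) u) (⊡-homo oA c _ u)
  ; Rz-comm = λ S u → trans (≗-cong oA (Rz-comm oB S) u) (Rz-comm oA _ u)
  ; Ry-stable = λ S u → trans (≗-cong oA (Ry-stable oB S) u) (trans (Ry-stable oA _ u)
      (Ry-cong (λ v → sym (≗-cong oA (Ry-stable oB S) (y ∷ v))) u))
  }

T : Forest → Operator
T []           = id
T (node g ∷ f) = graft (T g) ∘ T f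

T-isOp : ∀ f → IsOp (T f)
T-isOp []           = id-isOp
T-isOp (node g ∷ f) = ∘-isOp (graft-isOp (T-isOp g)) (T-isOp f)

-- The product of series and the coproduct rule.

⊛-cong : ∀ {S S′ V V′} → S ≗ S′ → V ≗ V′ → S ⊛ V ≗ S′ ⊛ V′
⊛-cong e e′ []      = cong₂ _*_ (e []) (e′ [])
⊛-cong e e′ (l ∷ u) = cong₂ _+_ (⊛-cong e (e′ ∘ (l ∷_)) u) (cong₂ _*_ (e′ []) (e (l ∷ u)))

⊛-⊞ʳ : ∀ S V W → S ⊛ (V ⊞ W) ≗ S ⊛ V ⊞ S ⊛ W
⊛-⊞ʳ S V W []      = arith (S []) (V []) (W [])
  where
  arith : ∀ a b c → a * (b + c) ≡ a * b + a * c
  arith = solve-∀ ℚ-ring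
⊛-⊞ʳ S V W (l ∷ u) = trans (cong (_+ (V [] + W []) * S (l ∷ u)) (⊛-⊞ʳ S (∂ l V) (∂ l W) u))
  (arith ((S ⊛ ∂ l V) u) _ (V []) (W []) (S (l ∷ u)))
  where
  arith : ∀ a b v w s → a + b + (v + w) * s ≡ a + v * s + (b + w * s)
  arith = solve-∀ ℚ-ring

⊛-⊡ʳ : ∀ S c V → S ⊛ (c ⊡ V) ≗ c ⊡ (S ⊛ V)
⊛-⊡ʳ S c V []      = arith (S []) c (V [])
  where
  arith : ∀ a c b → a * (c * b) ≡ c * (a * b)
  arith = solve-∀ ℚ-ring
⊛-⊡ʳ S c V (l ∷ u) = trans (cong (_+ c * V [] * S (l ∷ u)) (⊛-⊡ʳ S c (∂ l V) u))
  (arith c ((S ⊛ ∂ l V) u) (V []) (S (l ∷ u)))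
  where
  arith : ∀ c a v s → c * a + (c * v) * s ≡ c * (a + v * s)
  arith = solve-∀ ℚ-ring

⊛-𝟘ʳ : ∀ S → S ⊛ 𝟘 ≗ 𝟘
⊛-𝟘ʳ S u = trans (⊛-cong {S = S} (λ _ → refl) (λ _ → refl) u) (trans (⊛-⊡ʳ S 0ℚ 𝟘 u) (*-zeroˡ ((S ⊛ 𝟘) u)))

0+*-zero : ∀ {a b} c → a ≡ b → a + 0ℚ * c ≡ b
0+*-zero {a} c refl = arith a c
  where
  arith : ∀ a c → a + 0ℚ * c ≡ a
  arith = solve-∀ ℚ-ring

⊛-Rz : ∀ S V → S ⊛ Rz V ≗ Rz (S ⊛ V)
⊛-Rz S V []      = *-zeroʳ (S [])
⊛-Rz S V (z ∷ u) = 0+*-zero (S (z ∷ u)) refl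
⊛-Rz S V (y ∷ u) = 0+*-zero (S (y ∷ u)) (⊛-𝟘ʳ S u)

⊛-Ry : ∀ S V → S ⊛ Ry V ≗ Ry (S ⊛ V)
⊛-Ry S V []      = *-zeroʳ (S [])
⊛-Ry S V (z ∷ u) = 0+*-zero (S (z ∷ u)) (⊛-𝟘ʳ S u)
⊛-Ry S V (y ∷ u) = 0+*-zero (S (y ∷ u)) refl

Rz-∑ : ∀ {I : Set} (is : List I) (F : I → Series) → Rz (λ u → ∑ is (λ i → F i u)) ≗ λ u → ∑ is (λ i → Rz (F i) u)
Rz-∑ is F []      = sym (∑-0 is)
Rz-∑ is F (z ∷ u) = refl
Rz-∑ is F (y ∷ u) = sym (∑-0 is)

Ry-∑ : ∀ {I : Set} (is : List I) (F : I → Series) → Ry (λ u → ∑ is (λ i → F i u)) ≗ λ u → ∑ is (λ i → Ry (F i) u)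
Ry-∑ is F []      = sym (∑-0 is)
Ry-∑ is F (z ∷ u) = sym (∑-0 is)
Ry-∑ is F (y ∷ u) = refl

module _ {I : Set} (is : List I) (A : Operator) (F G : I → Operator)
         (oA : IsOp A) (oG : ∀ i → IsOp (G i))
         (A-⊛ : ∀ S V → A (S ⊛ V) ≗ λ u → ∑ is (λ i → (F i S ⊛ G i V) u)) where

  private
    °-⊛ : ∀ S V → (A °) (S ⊛ V) ≗ λ u → ∑ is (λ i → (F i S ⊛ (G i °) V) u)
    °-⊛ S V u = trans (≗-cong oA (λ v → sym (⊛-Ry S V v)) (y ∷ u))
      (trans (A-⊛ S (Ry V) (y ∷ u)) (∑-cong is λ i →
        -- By `Ry-stable` the series `G i (Ry V)` has constant term zero, so only its part ending in
        -- y contributes to the product.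
        trans (cong (λ c → (F i S ⊛ (G i °) V) u + c * F i S (y ∷ u)) (Ry-stable (oG i) V []))
              (0+*-zero (F i S (y ∷ u)) refl)))

    growth-⊛ : ∀ S V → growth A (S ⊛ V) ≗ λ u → ∑ is (λ i → (F i S ⊛ growth (G i) V) u)
    growth-⊛ S V u = trans
      (cong₂ _+_ (cong₂ _+_
         (trans (Rz-cong (°-⊛ S V) u) (Rz-∑ is _ u))
         (trans (Ry-cong (°-⊛ S V) u) (Ry-∑ is _ u)))
         (cong (-2ℚ *_) (trans (Rz-cong (A-⊛ S V) u) (Rz-∑ is _ u))))
      (trans (sym (trans (∑-+ is _ _) (cong₂ _+_ (∑-+ is _ _) (∑-* is -2ℚ _))))
      (∑-cong is λ i → sym
        (trans (⊛-⊞ʳ (F i S) (Rz ((G i °) V) ⊞ Ry ((G i °) V)) (-2ℚ ⊡ Rz (G i V)) u)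
        (cong₂ _+_
          (trans (⊛-⊞ʳ (F i S) (Rz ((G i °) V)) (Ry ((G i °) V)) u)
                 (cong₂ _+_ (⊛-Rz (F i S) ((G i °) V) u) (⊛-Ry (F i S) ((G i °) V) u)))
          (trans (⊛-⊡ʳ (F i S) -2ℚ (Rz (G i V)) u) (cong (-2ℚ *_) (⊛-Rz (F i S) (G i V) u)))))))

  -- The cocycle property Δ(B₊ f) = B₊ f ⊗ 𝕀 + (id ⊗ B₊) Δ(f), by induction on the last letter of V.
  -- On a product, `growth A` acts through the right factors only, since z and y are multiplied on
  -- the right; what comes from the constant term of V belongs to `graft A S ⊛ V`.
  graft-⊛ : ∀ S V → graft A (S ⊛ V) ≗ λ u → (graft A S ⊛ V) u + ∑ is (λ i → (F i S ⊛ graft (G i) V) u)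
  graft-⊛ S V [] = sym (trans
    (cong₂ _+_ (*-zeroˡ (V [])) (trans (∑-cong is (λ i → *-zeroʳ (F i S []))) (∑-0 is)))
    refl)
  graft-⊛ S V (z ∷ u) = trans
    (trans (graft-⊞ oA (S ⊛ ∂ z V) (V [] ⊡ ∂ z S) u)
           (cong₂ _+_ (graft-⊛ S (∂ z V) u) (graft-⊡ oA (V []) (∂ z S) u)))
    (trans (arith ((graft A S ⊛ ∂ z V) u) _ (V [] * graft A (∂ z S) u))
      (cong ((graft A S ⊛ V) (z ∷ u) +_) (∑-cong is λ i → sym (0+*-zero (F i S (z ∷ u)) refl))))
    where
    arith : ∀ a b c → a + b + c ≡ a + c + b
    arith = solve-∀ ℚ-ring
  graft-⊛ S V (y ∷ u) = trans
    (cong₂ _+_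
      (trans (graft-⊞ oA (S ⊛ ∂ y V) (V [] ⊡ ∂ y S) u)
             (cong₂ _+_ (graft-⊛ S (∂ y V) u) (graft-⊡ oA (V []) (∂ y S) u)))
      (trans (growth-⊞ oA (S ⊛ ∂ y V) (V [] ⊡ ∂ y S) u)
             (cong₂ _+_ (growth-⊛ S (∂ y V) u) (growth-⊡ oA (V []) (∂ y S) u))))
    (trans (arith ((graft A S ⊛ ∂ y V) u) _ (V []) (graft A (∂ y S) u) _ (growth A (∂ y S) u))
      (cong ((graft A S ⊛ V) (y ∷ u) +_) (trans (sym (∑-+ is _ _)) (∑-cong is λ i →
        sym (0+*-zero (F i S (y ∷ u)) (⊛-⊞ʳ (F i S) (graft (G i) (∂ y V)) (growth (G i) (∂ y V)) u))))))
    where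
    arith : ∀ a b v c d e → a + b + v * c + (d + v * e) ≡ a + v * (c + e) + (b + d)
    arith = solve-∀ ℚ-ring

T-++ : ∀ f g S → T (f ++ g) S ≡ T f (T g S)
T-++ []           g S = refl
T-++ (node h ∷ f) g S = cong (graft (T h)) (T-++ f g S)

-- Rule (IV) in the model, for arbitrary series in place of a word and a letter. The tree in front
-- is handled by the cocycle property, the product by multiplicativity of Δ.
T-⊛ : ∀ f S V → T f (S ⊛ V) ≗ λ u → ∑ (ΔF f) (λ p → (T (proj₁ p) S ⊛ T (proj₂ p) V) u)
T-⊛ []           S V u = sym (+-identityʳ _)
T-⊛ (node g ∷ f) S V u = begin
  graft (T g) (T f (S ⊛ V)) u
    ≡⟨ graft-cong (T-isOp g) (T-⊛ f S V) u ⟩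
  graft (T g) (λ v → ∑ (ΔF f) (λ q → (T (proj₁ q) S ⊛ T (proj₂ q) V) v)) u
    ≡⟨ ∑-homo (graft-isOp (T-isOp g)) (ΔF f) _ u ⟩
  ∑ (ΔF f) (λ q → graft (T g) (T (proj₁ q) S ⊛ T (proj₂ q) V) u)
    ≡⟨ ∑-cong (ΔF f) (λ q → trans
         (graft-⊛ (ΔF g) (T g) (T ∘ proj₁) (T ∘ proj₂) (T-isOp g) (T-isOp ∘ proj₂) (T-⊛ g) _ _ u)
         (cong ((graft (T g) (T (proj₁ q) S) ⊛ T (proj₂ q) V) u +_)
               (sym (∑-map (λ p → (proj₁ p , node (proj₂ p) ∷ [])) (ΔF g) _)))) ⟩
  ∑ (ΔF f) (λ q → ∑ (ΔT (node g)) (λ p → (T (proj₁ p) (T (proj₁ q) S) ⊛ T (proj₂ p) (T (proj₂ q) V)) u))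
    -- `T f` was expanded first, but `mulΔ` runs over the terms of the tree in its outer loop.
    ≡⟨ ∑-swap (ΔF f) (ΔT (node g)) _ ⟩
  ∑ (ΔT (node g)) (λ p → ∑ (ΔF f) (λ q → (T (proj₁ p) (T (proj₁ q) S) ⊛ T (proj₂ p) (T (proj₂ q) V)) u))
    ≡⟨ ∑-cong (ΔT (node g)) (λ p → trans
         (∑-cong (ΔF f) (λ q → cong₂ (λ X Y → (X ⊛ Y) u)
           (sym (T-++ (proj₁ p) (proj₁ q) S)) (sym (T-++ (proj₂ p) (proj₂ q) V))))
         (sym (∑-map (λ q → (proj₁ p ++ proj₁ q , proj₂ p ++ proj₂ q)) (ΔF f) _))) ⟩
  ∑ (ΔT (node g)) (λ p → ∑ (map (λ q → (proj₁ p ++ proj₁ q , proj₂ p ++ proj₂ q)) (ΔF f))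
                           (λ r → (T (proj₁ r) S ⊛ T (proj₂ r) V) u))
    ≡⟨ sym (∑-concatMap (λ p → map (λ q → (proj₁ p ++ proj₁ q , proj₂ p ++ proj₂ q)) (ΔF f)) (ΔT (node g)) _) ⟩
  ∑ (ΔF (node g ∷ f)) (λ r → (T (proj₁ r) S ⊛ T (proj₂ r) V) u) ∎
  where
  open ≡-Reasoning
  ∑-swap : ∀ {I J : Set} (is : List I) (js : List J) (F : I → J → ℚ) →
           ∑ is (λ i → ∑ js (F i)) ≡ ∑ js (λ j → ∑ is (λ i → F i j))
  ∑-swap []       js F = sym (∑-0 js)
  ∑-swap (i ∷ is) js F = trans (cong (∑ js (F i) +_) (∑-swap is js F)) (sym (∑-+ js (F i) _))

-- The composition formula for two grafted operators.

growth-congᴼ : ∀ {A B} → (∀ S → A S ≗ B S) → ∀ S → growth A S ≗ growth B S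
growth-congᴼ e S u = cong₂ _+_
  (cong₂ _+_ (Rz-cong (e (Ry S) ∘ (y ∷_)) u) (Ry-cong (e (Ry S) ∘ (y ∷_)) u))
  (cong (-2ℚ *_) (Rz-cong (e S) u))

graft-congᴼ : ∀ {A B} → (∀ S → A S ≗ B S) → ∀ S → graft A S ≗ graft B S
graft-congᴼ e S []      = refl
graft-congᴼ e S (z ∷ u) = graft-congᴼ e (∂ z S) u
graft-congᴼ e S (y ∷ u) = cong₂ _+_ (graft-congᴼ e (∂ y S) u) (growth-congᴼ e (∂ y S) u)

growth-comm : ∀ {A} → IsOp A → ∀ B C →
  A (growth B C) ≗ (Rz (A ((B °) C)) ⊞ Ry ((A °) ((B °) C))) ⊞ -2ℚ ⊡ Rz (A (B C))
growth-comm {A} o B C u = trans (⊞-homo o _ _ u) (cong₂ _+_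
  (trans (⊞-homo o _ _ u) (cong₂ _+_ (Rz-comm o _ u) (Ry-stable o _ u)))
  (trans (⊡-homo o -2ℚ _ u) (cong (-2ℚ *_) (Rz-comm o _ u))))

Rz-⊞-⊡ : ∀ X Y c W → Rz ((X ⊞ Y) ⊞ c ⊡ W) ≗ (Rz X ⊞ Rz Y) ⊞ c ⊡ Rz W
Rz-⊞-⊡ X Y c W u = trans (Rz-⊞ _ _ u) (cong₂ _+_ (Rz-⊞ X Y u) (Rz-⊡ c W u))

-- The part of the recursion for graft A ∘ graft B that depends on A and B
-- only through A ∘ B.
excess : Operator → Operator
excess M C u = (- Rz (Rz ((M °) C)) u + (-2ℚ + - 1ℚ) * Rz (Ry ((M °) C)) u) + (-2ℚ * -2ℚ) * Rz (Rz (M C)) u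

module _ {A B : Operator} (oA : IsOp A) (oB : IsOp B) where

  °-∘ : ∀ C → (A °) ((B °) C) ≗ ((A ∘ B) °) C
  °-∘ C u = sym (≗-cong oA (Ry-stable oB C) (y ∷ u))

  private
    -- Solves `(graft A °) = graft A + growth A` for `graft A` at the series `(B °) C`. All terms
    -- but the last become composites with B; that last one cancels in `graft-graft`.
    graft-° : ∀ C → graft A ((B °) C) ≗
              (((graft A ∘ B) °) C ⊞ (- 1ℚ) ⊡ (Rz (((A ∘ B) °) C) ⊞ Ry (((A ∘ B) °) C))) ⊞ (- -2ℚ) ⊡ Rz (A ((B °) C))
    graft-° C u = trans (arith (graft A X u) (Rz ((A °) X) u) (Ry ((A °) X) u) (Rz (A X) u))
      (cong (λ q → ((graft A ∘ B) °) C u + - 1ℚ * q + - -2ℚ * Rz (A X) u)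
            (cong₂ _+_ (Rz-cong (°-∘ C) u) (Ry-cong (°-∘ C) u)))
      where
      X = (B °) C
      arith : ∀ a q q′ r → a ≡ (a + ((q + q′) + -2ℚ * r)) + - 1ℚ * (q + q′) + - -2ℚ * r
      arith = solve-∀ ℚ-ring

  -- Both recursions are expanded at a last letter y. The terms containing `A ((B °) C)` occur with
  -- coefficients 2 and -2 and disappear; everything else is a growth term of a mixed composite or
  -- depends on `A ∘ B` alone.
  graft-graft : ∀ S u → let C = ∂ y S in
    graft A (graft B S) (y ∷ u) ≡
    graft A (graft B C) u + ((growth (graft A ∘ B) C u + growth (A ∘ graft B) C u) + excess (A ∘ B) C u)
  graft-graft S u = trans
    (cong₂ _+_ (trans (graft-⊞ oA (graft B C) (growth B C) u) (cong (graft A (graft B C) u +_) step₁)) step₂)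
    (arith (graft A (graft B C) u) (Rz P u) (Ry P u) (Rz (graft A (B C)) u) (Rz R u) (Ry R u) (Rz (A (graft B C)) u)
           (Rz (Rz Q) u) (Rz (Ry Q) u) (Rz (Rz (A X)) u) (Rz (Rz (A (B C))) u))
    where
    C = ∂ y S
    X = (B °) C
    P = ((graft A ∘ B) °) C
    Q = ((A ∘ B) °) C
    R = ((A ∘ graft B) °) C
    step₁ : graft A (growth B C) u ≡
            Rz P u + - 1ℚ * (Rz (Rz Q) u + Rz (Ry Q) u) + - -2ℚ * Rz (Rz (A X)) u + Ry P u + -2ℚ * Rz (graft A (B C)) u
    step₁ = trans (growth-comm (graft-isOp oA) B C u) (cong (_+ -2ℚ * Rz (graft A (B C)) u) (cong₂ _+_
      (trans (Rz-cong (graft-° C) u) (trans (Rz-⊞-⊡ P ((- 1ℚ) ⊡ (Rz Q ⊞ Ry Q)) (- -2ℚ) (Rz (A X)) u)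
        (cong (λ q → Rz P u + q + - -2ℚ * Rz (Rz (A X)) u)
          (trans (Rz-⊡ (- 1ℚ) (Rz Q ⊞ Ry Q) u) (cong (- 1ℚ *_) (Rz-⊞ (Rz Q) (Ry Q) u))))))
      (Ry-cong (λ v → sym (graft-cong oA (Ry-stable oB C) (y ∷ v))) u)))
    step₂ : growth A (graft B C ⊞ growth B C) u ≡
            Rz R u + Ry R u + -2ℚ * (Rz (A (graft B C)) u + (Rz (Rz (A X)) u + Rz (Ry Q) u + -2ℚ * Rz (Rz (A (B C))) u))
    step₂ = cong₂ _+_
      (cong₂ _+_ (Rz-cong A°D≗R u) (Ry-cong A°D≗R u))
      (cong (-2ℚ *_) (trans (Rz-cong (⊞-homo oA (graft B C) (growth B C)) u)
        (trans (Rz-⊞ _ _ u) (cong (Rz (A (graft B C)) u +_)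
        (trans (Rz-cong (growth-comm oA B C) u) (trans (Rz-⊞-⊡ _ _ -2ℚ _ u)
        (cong (λ q → Rz (Rz (A X)) u + q + -2ℚ * Rz (Rz (A (B C))) u)
              (Rz-cong (Ry-cong (°-∘ C)) u))))))))
      where
      A°D≗R : (A °) (graft B C ⊞ growth B C) ≗ R
      A°D≗R v = sym (≗-cong oA (graft-Ry oB C) (y ∷ v))
    arith : ∀ a p p′ g r r′ h t t′ m n →
      a + (p + - 1ℚ * (t + t′) + - -2ℚ * m + p′ + -2ℚ * g) + (r + r′ + -2ℚ * (h + (m + t′ + -2ℚ * n))) ≡
      a + ((p + p′ + -2ℚ * g + (r + r′ + -2ℚ * h)) + ((- t + (-2ℚ + - 1ℚ) * t′) + (-2ℚ * -2ℚ) * n))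
    arith = solve-∀ ℚ-ring

-- The operator of the one-vertex tree.
E : Operator
E = graft id

-- Both sides satisfy the recursion graft-graft with the same A ∘ B, so the
-- difference of graft A ∘ graft B and the terms of Rota–Baxter type does not
-- change when (A , B) is replaced by (id , A ∘ B).
graft-∘-graft : ∀ {A B} → IsOp A → IsOp B → ∀ S → graft A (graft B S) ≗
  ((graft (graft A ∘ B) S ⊞ graft (A ∘ graft B) S) ⊞ E (graft (A ∘ B) S))
    ⊞ (- 1ℚ) ⊡ (graft (E ∘ A ∘ B) S ⊞ graft (graft (A ∘ B)) S)
graft-∘-graft oA oB S [] = refl
graft-∘-graft oA oB S (z ∷ u) = graft-∘-graft oA oB (∂ z S) u
graft-∘-graft {A} {B} oA oB S (y ∷ u) = trans (graft-graft oA oB S u)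
  (trans (cong (_+ (growth (graft A ∘ B) C u + growth (A ∘ graft B) C u + excess (A ∘ B) C u)) (graft-∘-graft oA oB C u))
  (trans (arith (graft (graft A ∘ B) C u) (graft (A ∘ graft B) C u) (E (graft (A ∘ B) C) u)
                (graft (E ∘ A ∘ B) C u) (graft (graft (A ∘ B)) C u)
                (growth (graft A ∘ B) C u) (growth (A ∘ graft B) C u) (excess (A ∘ B) C u)
                (growth (E ∘ A ∘ B) C u) (growth (graft (A ∘ B)) C u))
    (cong (λ e → graft (graft A ∘ B) S (y ∷ u) + graft (A ∘ graft B) S (y ∷ u) + e
                 + - 1ℚ * (graft (E ∘ A ∘ B) S (y ∷ u) + graft (graft (A ∘ B)) S (y ∷ u)))
          (sym (graft-graft id-isOp (∘-isOp oA oB) S u)))))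
  where
  C = ∂ y S
  arith : ∀ a b e c d a′ b′ r c′ d′ →
    a + b + e + - 1ℚ * (c + d) + (a′ + b′ + r) ≡
    a + a′ + (b + b′) + (e + (c′ + d′ + r)) + - 1ℚ * (c + c′ + (d + d′))
  arith = solve-∀ ℚ-ring

-- For a single tree this is the case B = id of `graft-∘-graft`: once E commutes with `T g`, by
-- induction, all terms cancel except `E (graft A V)`.
E-comm : ∀ f S → T f (E S) ≗ E (T f S)
E-comm []           S u = refl
E-comm (node g ∷ f) S u = trans (graft-cong oA (E-comm f S) u)
  (trans (graft-∘-graft oA id-isOp (T f S) u)
  (trans (cong (λ q → graft (graft A) V u + q + E (graft A V) u + - 1ℚ * (graft (E ∘ A) V u + graft (graft A) V u))
               (graft-congᴼ (E-comm g) V u))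
    (arith (graft (graft A) V u) (graft (E ∘ A) V u) (E (graft A V) u))))
  where
  A = T g
  V = T f S
  oA = T-isOp g
  arith : ∀ a b c → a + b + c + - 1ℚ * (b + a) ≡ c
  arith = solve-∀ ℚ-ring

-- Spanning in the model.

TH : H → Operator
TH h S u = ∑ h (λ a → proj₁ a * T (proj₂ a) S u)

module _ {I : Set} (is : List I) (c : I → ℚ) (A : I → Operator) where

  private
    ∑A : Operator
    ∑A S u = ∑ is (λ i → c i * A i S u)

    Rz-∑A : ∀ (F : I → Series) → Rz (λ u → ∑ is (λ i → c i * F i u)) ≗ λ u → ∑ is (λ i → c i * Rz (F i) u)
    Rz-∑A F u = trans (Rz-∑ is _ u) (∑-cong is λ i → Rz-⊡ (c i) (F i) u)

    Ry-∑A : ∀ (F : I → Series) → Ry (λ u → ∑ is (λ i → c i * F i u)) ≗ λ u → ∑ is (λ i → c i * Ry (F i) u)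
    Ry-∑A F u = trans (Ry-∑ is _ u) (∑-cong is λ i → Ry-⊡ (c i) (F i) u)

  growth-∑ : ∀ S → growth ∑A S ≗ λ u → ∑ is (λ i → c i * growth (A i) S u)
  growth-∑ S u = trans
    (cong₂ _+_ (cong₂ _+_ (Rz-∑A (λ i → (A i °) S) u) (Ry-∑A (λ i → (A i °) S) u))
               (cong (-2ℚ *_) (Rz-∑A (λ i → A i S) u)))
    (trans (sym (trans (∑-+ is _ _) (cong₂ _+_ (∑-+ is _ _) (∑-* is -2ℚ _))))
           (∑-cong is λ i → arith (c i) (Rz ((A i °) S) u) (Ry ((A i °) S) u) -2ℚ (Rz (A i S) u)))
    where
    arith : ∀ c a b k d → c * a + c * b + k * (c * d) ≡ c * (a + b + k * d)
    arith = solve-∀ ℚ-ring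

  graft-∑ : ∀ S → graft ∑A S ≗ λ u → ∑ is (λ i → c i * graft (A i) S u)
  graft-∑ S []      = sym (trans (∑-cong is λ i → *-zeroʳ (c i)) (∑-0 is))
  graft-∑ S (z ∷ u) = graft-∑ (∂ z S) u
  graft-∑ S (y ∷ u) = trans (cong₂ _+_ (graft-∑ (∂ y S) u) (growth-∑ (∂ y S) u))
    (trans (sym (∑-+ is _ _)) (∑-cong is λ i → arith (c i) (graft (A i) (∂ y S) u) (growth (A i) (∂ y S) u)))
    where
    arith : ∀ c a b → c * a + c * b ≡ c * (a + b)
    arith = solve-∀ ℚ-ring

Spanned : Operator → Set
Spanned A = ∃ λ (us : H) → All (InU ∘ proj₂) us × (∀ S → A S ≗ TH us S)

spanned-cong : ∀ {A B} → (∀ S → A S ≗ B S) → Spanned B → Spanned A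
spanned-cong e (us , inU , eq) = us , inU , λ S u → trans (e S u) (eq S u)

spanned-T : ∀ {f} → InU f → Spanned (T f)
spanned-T {f} p = (1ℚ , f) ∷ [] , p ∷ [] , λ S u → arith (T f S u)
  where
  arith : ∀ a → a ≡ 1ℚ * a + 0ℚ
  arith = solve-∀ ℚ-ring

spanned-⊞ : ∀ {A B} → Spanned A → Spanned B → Spanned (λ S → A S ⊞ B S)
spanned-⊞ (us , inU , eq) (us′ , inU′ , eq′) =
  us ++ us′ , ++⁺ inU inU′ , λ S u → trans (cong₂ _+_ (eq S u) (eq′ S u)) (sym (∑-++ us us′ _))

spanned-⊡ : ∀ c {A} → Spanned A → Spanned (λ S → c ⊡ A S)
spanned-⊡ c (us , inU , eq) = map (λ a → (c * proj₁ a , proj₂ a)) us , map⁺ inU , λ S u →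
  trans (cong (c *_) (eq S u)) (trans (sym (∑-* us c _)) (trans
    (∑-cong us (λ a → sym (*-assoc c (proj₁ a) _))) (sym (∑-map _ us _))))

spanned-∑ : ∀ {I : Set} (is : List I) (c : I → ℚ) (A : I → Operator) →
            All (Spanned ∘ A) is → Spanned (λ S u → ∑ is (λ i → c i * A i S u))
spanned-∑ []       c A []       = [] , [] , λ S u → refl
spanned-∑ (i ∷ is) c A (p ∷ ps) = spanned-⊞ (spanned-⊡ (c i) p) (spanned-∑ is c A ps)

spanned-graft : ∀ {A} → Spanned A → Spanned (graft A)
spanned-graft (us , inU , eq) = spanned-cong
  (λ S u → trans (graft-congᴼ eq S u) (graft-∑ us proj₁ (T ∘ proj₂) S u))
  (spanned-∑ us proj₁ (λ a → T (B₊ (proj₂ a) ∷ [])) (All.map (λ p → spanned-T (u-B₊ p)) inU))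

∑-homo-* : ∀ {A} → IsOp A → ∀ {I : Set} (is : List I) (c : I → ℚ) (F : I → Series) →
           A (λ u → ∑ is (λ i → c i * F i u)) ≗ λ u → ∑ is (λ i → c i * A (F i) u)
∑-homo-* o is c F u = trans (∑-homo o is _ u) (∑-cong is λ i → ⊡-homo o (c i) (F i) u)

spanned-E : ∀ {A} → Spanned A → Spanned (E ∘ A)
spanned-E (us , inU , eq) = spanned-cong
  (λ S u → trans (graft-cong id-isOp (eq S) u) (∑-homo-* (graft-isOp id-isOp) us proj₁ _ u))
  (spanned-∑ us proj₁ (λ a → T (• ∷ proj₂ a)) (All.map (λ p → spanned-T (u-dot p)) inU))

-- A factor • on either side is pulled out as E by `E-comm`, which leaves two forests of the form
-- B₊. In the composition formula for these, every product on the right strips B₊ from at least one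
-- factor, so the recursion ends.
spanned-∘ : ∀ {f g} → InU f → InU g → Spanned (T f ∘ T g)
spanned-∘ u-nil q = spanned-T q
spanned-∘ (u-dot p) q = spanned-E (spanned-∘ p q)
spanned-∘ (u-B₊ p) u-nil = spanned-T (u-B₊ p)
spanned-∘ (u-B₊ {f} p) (u-dot {g} q) =
  spanned-cong (λ S → E-comm (B₊ f ∷ []) (T g S)) (spanned-E (spanned-∘ (u-B₊ p) q))
spanned-∘ (u-B₊ {f} p) (u-B₊ {g} q) =
  spanned-cong (graft-∘-graft (T-isOp f) (T-isOp g))
    (spanned-⊞
      (spanned-⊞ (spanned-⊞ (spanned-graft (spanned-∘ (u-B₊ p) q)) (spanned-graft (spanned-∘ p (u-B₊ q))))
                 (spanned-E (spanned-graft (spanned-∘ p q))))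
      (spanned-⊡ (- 1ℚ) (spanned-⊞ (spanned-graft (spanned-E (spanned-∘ p q)))
                                   (spanned-graft (spanned-graft (spanned-∘ p q))))))

-- By induction the forest under the first root and the remaining forest are both combinations of U.
-- Linearity of `graft` in the operator and of operators in the series reduces the product to pairs
-- covered by `spanned-∘`.
spanned-T-forest : ∀ f → Spanned (T f)
spanned-T-forest []           = spanned-T u-nil
spanned-T-forest (node g ∷ f) with spanned-T-forest g | spanned-T-forest f
... | us , inU , eq | vs , inV , eq′ = spanned-cong
  (λ S u → trans (graft-congᴼ eq (T f S) u) (trans (graft-∑ us proj₁ (T ∘ proj₂) (T f S) u)
    (∑-cong us λ a → cong (proj₁ a *_)
      (trans (graft-cong (T-isOp (proj₂ a)) (eq′ S) u)
             (∑-homo-* (graft-isOp (T-isOp (proj₂ a))) vs proj₁ _ u)))))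
  (spanned-∑ us proj₁ _ (All.map
    (λ {a} p → spanned-∑ vs proj₁ (λ b → graft (T (proj₂ a)) ∘ T (proj₂ b))
                 (All.map (λ q → spanned-∘ (u-B₊ p) q) inV))
    inU))

spanned-TH : ∀ h → Spanned (TH h)
spanned-TH h = spanned-∑ h proj₁ (T ∘ proj₂) (All.universal (λ a → spanned-T-forest (proj₂ a)) h)

-- Polynomials in x and y as series in z and y.

R : Letter → Operator
R x S = Rz S ⊞ (- 1ℚ) ⊡ Ry S
R y S = Ry S

-- The reversal of w, with z - y substituted for x.
monoˢ : Word → Series
monoˢ []      = 𝟙
monoˢ (l ∷ w) = R l (monoˢ w)

⟦_⟧ : Poly → Series
⟦ p ⟧ u = ∑ p (λ m → proj₁ m * monoˢ (reverse (proj₂ m)) u)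

R-cong : ∀ l {S S′} → S ≗ S′ → R l S ≗ R l S′
R-cong x e u = cong₂ (λ a b → a + - 1ℚ * b) (Rz-cong e u) (Ry-cong e u)
R-cong y e u = Ry-cong e u

⊛-R : ∀ l S V → S ⊛ R l V ≗ R l (S ⊛ V)
⊛-R x S V u = trans (⊛-⊞ʳ S (Rz V) ((- 1ℚ) ⊡ Ry V) u)
  (cong₂ _+_ (⊛-Rz S V u) (trans (⊛-⊡ʳ S (- 1ℚ) (Ry V) u) (cong (- 1ℚ *_) (⊛-Ry S V u))))
⊛-R y S V u = ⊛-Ry S V u

⊛-identityʳ : ∀ S → S ⊛ 𝟙 ≗ S
⊛-identityʳ S []      = arith (S [])
  where
  arith : ∀ a → a * 1ℚ ≡ a
  arith = solve-∀ ℚ-ring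
⊛-identityʳ S (l ∷ u) = trans (cong (_+ 1ℚ * S (l ∷ u)) (⊛-𝟘ʳ S u)) (arith (S (l ∷ u)))
  where
  arith : ∀ a → 0ℚ + 1ℚ * a ≡ a
  arith = solve-∀ ℚ-ring

monoˢ-++ : ∀ v w → monoˢ (v ++ w) ≗ monoˢ w ⊛ monoˢ v
monoˢ-++ []      w u = sym (⊛-identityʳ (monoˢ w) u)
monoˢ-++ (l ∷ v) w u = trans (R-cong l (monoˢ-++ v w) u) (sym (⊛-R l (monoˢ w) (monoˢ v) u))

⊛-∑ˡ : ∀ {I : Set} (is : List I) (c : I → ℚ) (F : I → Series) V →
       (λ u → ∑ is (λ i → c i * F i u)) ⊛ V ≗ λ u → ∑ is (λ i → c i * (F i ⊛ V) u)
⊛-∑ˡ is c F V [] = trans (arith (∑ is (λ i → c i * F i [])) (V []))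
  (trans (sym (∑-* is (V []) _)) (∑-cong is λ i → arith′ (V []) (c i) (F i [])))
  where
  arith : ∀ a b → a * b ≡ b * a
  arith = solve-∀ ℚ-ring
  arith′ : ∀ a b c → a * (b * c) ≡ b * (c * a)
  arith′ = solve-∀ ℚ-ring
⊛-∑ˡ is c F V (l ∷ u) = trans (cong₂ _+_ (⊛-∑ˡ is c F (∂ l V) u) (sym (∑-* is (V []) _)))
  (trans (sym (∑-+ is _ _)) (∑-cong is λ i → arith (c i) ((F i ⊛ ∂ l V) u) (V []) (F i (l ∷ u))))
  where
  arith : ∀ c a v b → c * a + v * (c * b) ≡ c * (a + v * b)
  arith = solve-∀ ℚ-ring

⊛-∑ʳ : ∀ {I : Set} S (is : List I) (c : I → ℚ) (F : I → Series) →
       S ⊛ (λ u → ∑ is (λ i → c i * F i u)) ≗ λ u → ∑ is (λ i → c i * (S ⊛ F i) u)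
⊛-∑ʳ S []       c F u = ⊛-𝟘ʳ S u
⊛-∑ʳ S (i ∷ is) c F u = trans (⊛-⊞ʳ S (c i ⊡ F i) _ u) (cong₂ _+_ (⊛-⊡ʳ S (c i) (F i) u) (⊛-∑ʳ S is c F u))

⟦⟧-⊗ : ∀ p q → ⟦ p ⊗ q ⟧ ≗ ⟦ p ⟧ ⊛ ⟦ q ⟧
⟦⟧-⊗ p q u = begin
  ⟦ p ⊗ q ⟧ u
    ≡⟨ ∑-concatMap (λ a → map (_·_ a) q) p _ ⟩
  ∑ p (λ a → ∑ (map (_·_ a) q) (λ m → proj₁ m * W m u))
    ≡⟨ ∑-cong p (λ a → trans (∑-map (_·_ a) q _) (trans (∑-cong q (term a)) (∑-* q (proj₁ a) _))) ⟩
  ∑ p (λ a → proj₁ a * ∑ q (λ b → proj₁ b * (W a ⊛ W b) u))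
    ≡⟨ ∑-cong p (λ a → cong (proj₁ a *_) (sym (⊛-∑ʳ (W a) q proj₁ W u))) ⟩
  ∑ p (λ a → proj₁ a * (W a ⊛ ⟦ q ⟧) u)
    ≡⟨ sym (⊛-∑ˡ p proj₁ W ⟦ q ⟧ u) ⟩
  (⟦ p ⟧ ⊛ ⟦ q ⟧) u ∎
  where
  open ≡-Reasoning
  W : ℚ × Word → Series
  W m = monoˢ (reverse (proj₂ m))
  _·_ : ℚ × Word → ℚ × Word → ℚ × Word
  a · b = proj₁ a * proj₁ b , proj₂ a ++ proj₂ b
  term : ∀ a b → proj₁ (a · b) * W (a · b) u ≡ proj₁ a * (proj₁ b * (W a ⊛ W b) u)
  term a b = trans (*-assoc (proj₁ a) (proj₁ b) _) (cong (λ s → proj₁ a * (proj₁ b * s))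
    (trans (cong (λ w → monoˢ w u) (reverse-++ (proj₂ a) (proj₂ b)))
           (monoˢ-++ (reverse (proj₂ b)) (reverse (proj₂ a)) u)))

⟦⟧-scale : ∀ c p → ⟦ scale c p ⟧ ≗ c ⊡ ⟦ p ⟧
⟦⟧-scale c p u = trans (∑-map _ p _) (trans (∑-cong p λ m → *-assoc c (proj₁ m) _) (∑-* p c _))

⟦⟧-sumP : ∀ {I : Set} (h : I → Poly) (is : List I) → ⟦ sumP (map h is) ⟧ ≗ λ u → ∑ is (λ i → ⟦ h i ⟧ u)
⟦⟧-sumP h []       u = refl
⟦⟧-sumP h (i ∷ is) u = trans (∑-++ (h i) (sumP (map h is)) _) (cong (⟦ h i ⟧ u +_) (⟦⟧-sumP h is u))

⟦⟧-mono : ∀ w → ⟦ mono w ⟧ ≗ monoˢ (reverse w)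
⟦⟧-mono w u = arith (monoˢ (reverse w) u)
  where
  arith : ∀ a → 1ℚ * a + 0ℚ ≡ a
  arith = solve-∀ ℚ-ring

-- F gives the coefficients, again at reversed words in x and y.
substˣ : (Word → ℚ) → Series
substˣ F []      = F []
substˣ F (z ∷ u) = substˣ (λ w → F (x ∷ w)) u
substˣ F (y ∷ u) = substˣ (λ w → F (y ∷ w) + - F (x ∷ w)) u

substˣ-cong : ∀ {F G} → F ≗ G → substˣ F ≗ substˣ G
substˣ-cong e []      = e []
substˣ-cong e (z ∷ u) = substˣ-cong (e ∘ (x ∷_)) u
substˣ-cong e (y ∷ u) = substˣ-cong (λ w → cong₂ (λ a b → a + - b) (e (y ∷ w)) (e (x ∷ w))) u

substˣ-lin : ∀ c F G → substˣ (λ w → c * F w + G w) ≗ c ⊡ substˣ F ⊞ substˣ G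
substˣ-lin c F G []      = refl
substˣ-lin c F G (z ∷ u) = substˣ-lin c _ _ u
substˣ-lin c F G (y ∷ u) = trans
  (substˣ-cong (λ w → arith c (F (y ∷ w)) (G (y ∷ w)) (F (x ∷ w)) (G (x ∷ w))) u)
  (substˣ-lin c _ _ u)
  where
  arith : ∀ c a b a′ b′ → c * a + b + - (c * a′ + b′) ≡ c * (a + - a′) + (b + - b′)
  arith = solve-∀ ℚ-ring

substˣ-0 : ∀ u → substˣ (λ _ → 0ℚ) u ≡ 0ℚ
substˣ-0 []      = refl
substˣ-0 (z ∷ u) = substˣ-0 u
substˣ-0 (y ∷ u) = trans (substˣ-cong (λ _ → refl) u) (substˣ-0 u)

-- The substitution x = z - y is invertible: the coefficient at a last letter z is the one at x, and
-- adding it to the coefficient at y undoes the subtraction.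
substˣ-injective : ∀ {F G} → substˣ F ≗ substˣ G → F ≗ G
substˣ-injective e []      = e []
substˣ-injective e (x ∷ w) = substˣ-injective (e ∘ (z ∷_)) w
substˣ-injective {F} {G} e (y ∷ w) = begin
  F (y ∷ w)                             ≡⟨ arith (F (y ∷ w)) (F (x ∷ w)) ⟩
  F (y ∷ w) + - F (x ∷ w) + F (x ∷ w)   ≡⟨ cong₂ _+_ (substˣ-injective (e ∘ (y ∷_)) w) (substˣ-injective (e ∘ (z ∷_)) w) ⟩
  G (y ∷ w) + - G (x ∷ w) + G (x ∷ w)   ≡⟨ sym (arith (G (y ∷ w)) (G (x ∷ w))) ⟩
  G (y ∷ w) ∎
  where
  open ≡-Reasoning
  arith : ∀ a b → a ≡ a + - b + b
  arith = solve-∀ ℚ-ring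

δ : Word → Word → ℚ
δ v w = if does (v ≟W w) then 1ℚ else 0ℚ

coeff-∷ : ∀ c v p w → coeff ((c , v) ∷ p) w ≡ c * δ v w + coeff p w
coeff-∷ c v p w with v ≟W w
... | yes _ = cong (_+ coeff p w) (arith c)
  where
  arith : ∀ a → a ≡ a * 1ℚ
  arith = solve-∀ ℚ-ring
... | no  _ = arith c (coeff p w)
  where
  arith : ∀ c a → a ≡ c * 0ℚ + a
  arith = solve-∀ ℚ-ring

δ-reverse : ∀ v w → δ v (reverse w) ≡ δ (reverse v) w
δ-reverse v w with v ≟W reverse w | reverse v ≟W w
... | yes _ | yes _ = refl
... | no  _ | no  _ = refl
... | yes p | no ¬q = contradiction (trans (cong reverse p) (reverse-involutive w)) ¬q
... | no ¬p | yes q = contradiction (trans (sym (reverse-involutive v)) (cong reverse q)) ¬p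

monoˢ≗substˣ : ∀ v → monoˢ v ≗ substˣ (δ v)
monoˢ≗substˣ []      []      = refl
monoˢ≗substˣ []      (z ∷ u) = sym (substˣ-0 u)
monoˢ≗substˣ []      (y ∷ u) = sym (substˣ-0 (y ∷ u))
monoˢ≗substˣ (x ∷ v) []      = refl
monoˢ≗substˣ (y ∷ v) []      = refl
monoˢ≗substˣ (x ∷ v) (z ∷ u) = trans (arith (monoˢ v u)) (monoˢ≗substˣ v u)
  where
  arith : ∀ a → a + - 1ℚ * 0ℚ ≡ a
  arith = solve-∀ ℚ-ring
monoˢ≗substˣ (x ∷ v) (y ∷ u) = sym (trans (substˣ-cong (λ w → arith (δ v w)) u)
  (trans (substˣ-lin (- 1ℚ) (δ v) (λ _ → 0ℚ) u)
  (trans (cong₂ (λ a b → - 1ℚ * a + b) (sym (monoˢ≗substˣ v u)) (substˣ-0 u)) (arith′ (monoˢ v u)))))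
  where
  arith : ∀ a → 0ℚ + - a ≡ - 1ℚ * a + 0ℚ
  arith = solve-∀ ℚ-ring
  arith′ : ∀ a → - 1ℚ * a + 0ℚ ≡ 0ℚ + - 1ℚ * a
  arith′ = solve-∀ ℚ-ring
monoˢ≗substˣ (y ∷ v) (z ∷ u) = sym (substˣ-0 u)
monoˢ≗substˣ (y ∷ v) (y ∷ u) = trans (monoˢ≗substˣ v u) (substˣ-cong (λ w → arith (δ v w)) u)
  where
  arith : ∀ a → a ≡ a + - 0ℚ
  arith = solve-∀ ℚ-ring

-- Shows that `⟦ p ⟧` depends only on the coefficients of p and not on the list that represents it.
-- Both passages between `_≈_` and equality of series rest on this.
⟦⟧≗substˣ : ∀ p → ⟦ p ⟧ ≗ substˣ (coeff p ∘ reverse)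
⟦⟧≗substˣ []            u = sym (substˣ-0 u)
⟦⟧≗substˣ ((c , v) ∷ p) u = sym (trans
  (substˣ-cong (λ w → trans (coeff-∷ c v p (reverse w)) (cong (λ d → c * d + coeff p (reverse w)) (δ-reverse v w))) u)
  (trans (substˣ-lin c (δ (reverse v)) (coeff p ∘ reverse) u)
  (sym (cong₂ (λ a b → c * a + b) (monoˢ≗substˣ (reverse v) u) (⟦⟧≗substˣ p u)))))

⟦⟧-cong : ∀ p q → p ≈ q → ⟦ p ⟧ ≗ ⟦ q ⟧
⟦⟧-cong p q e u = trans (⟦⟧≗substˣ p u) (trans (substˣ-cong (e ∘ reverse) u) (sym (⟦⟧≗substˣ q u)))

⟦⟧-injective : ∀ p q → ⟦ p ⟧ ≗ ⟦ q ⟧ → p ≈ q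
⟦⟧-injective p q e w = subst (λ v → coeff p v ≡ coeff q v) (reverse-involutive w)
  (substˣ-injective (λ u → trans (sym (⟦⟧≗substˣ p u)) (trans (e u) (⟦⟧≗substˣ q u))) (reverse w))

-- Agreement of every rooted tree map with the model.

∣_∣ : Forest → ℕ
∣ [] ∣         = 0
∣ node g ∷ f ∣ = suc ∣ g ∣ +ᴺ ∣ f ∣

∣++∣ : ∀ f g → ∣ f ++ g ∣ ≡ ∣ f ∣ +ᴺ ∣ g ∣
∣++∣ []           g = refl
∣++∣ (node h ∷ f) g = trans (cong (suc ∣ h ∣ +ᴺ_) (∣++∣ f g)) (sym (ℕ.+-assoc (suc ∣ h ∣) ∣ f ∣ ∣ g ∣))

Bounded : ℕ → Forest × Forest → Set
Bounded n p = ∣ proj₁ p ∣ ≤ᴺ n × ∣ proj₂ p ∣ ≤ᴺ n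

-- The bound on the number of vertices cannot be strict, because f ⊗ 𝕀 and 𝕀 ⊗ f occur in Δ(f). An
-- induction through rule (IV) therefore fixes the bound and shortens the word.
ΔF-bounded : ∀ f → All (Bounded ∣ f ∣) (ΔF f)
ΔF-bounded []           = (z≤n , z≤n) ∷ []
ΔF-bounded (node g ∷ f) = concat⁺ (map⁺ (All.map (λ {a} (a₁ , a₂) →
    map⁺ (All.map (λ {b} (b₁ , b₂) → add (proj₁ a) (proj₁ b) a₁ b₁ , add (proj₂ a) (proj₂ b) a₂ b₂) (ΔF-bounded f)))
  (ΔT-bounded)))
  where
  n = suc (∣ g ∣ +ᴺ 0)
  ΔT-bounded : All (Bounded n) (ΔT (node g))
  ΔT-bounded = (ℕ.≤-refl , z≤n) ∷ map⁺ (All.map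
    (λ (a₁ , a₂) → ℕ.≤-trans a₁ (ℕ.m≤n⇒m≤1+n (ℕ.m≤m+n ∣ g ∣ 0)) , s≤s (ℕ.+-monoˡ-≤ 0 a₂)) (ΔF-bounded g))
  add : ∀ a b → ∣ a ∣ ≤ᴺ n → ∣ b ∣ ≤ᴺ ∣ f ∣ → ∣ a ++ b ∣ ≤ᴺ ∣ node g ∷ f ∣
  add a b p q = subst (_≤ᴺ ∣ node g ∷ f ∣) (sym (∣++∣ a b))
    (ℕ.+-mono-≤ (subst (λ k → ∣ a ∣ ≤ᴺ suc k) (ℕ.+-identityʳ ∣ g ∣) p) q)

graft-𝟙 : ∀ {A} → IsOp A → graft A 𝟙 ≗ 𝟘
graft-𝟙 o []      = refl
graft-𝟙 o (z ∷ u) = graft-𝟘 o u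
graft-𝟙 o (y ∷ u) = graft-𝟘 o (y ∷ u)

T-𝟙 : ∀ t f → T (t ∷ f) 𝟙 ≗ 𝟘
T-𝟙 (node g) []      = graft-𝟙 (T-isOp g)
T-𝟙 (node g) (t ∷ f) u = trans (graft-cong (T-isOp g) (T-𝟙 t f) u) (graft-𝟘 (T-isOp g) u)

graft-°-𝟙 : ∀ {A} → IsOp A → (graft A °) 𝟙 ≗ growth A 𝟙
graft-°-𝟙 {A} o u = trans (cong (_+ growth A 𝟙 u) (graft-𝟙 o u)) (arith (growth A 𝟙 u))
  where
  arith : ∀ a → 0ℚ + a ≡ a
  arith = solve-∀ ℚ-ring

graft-y : ∀ {A} → IsOp A → graft A (monoˢ (y ∷ [])) ≗ Ry (growth A 𝟙)
graft-y {A} o u = trans (graft-Ry o 𝟙 u) (Ry-cong (graft-°-𝟙 o) u)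

-- Since x = z - y and A(z) = A(1) z = 0. This is the sign relation between the values on x and y in
-- rules (I) and (II).
op-x : ∀ {A} → IsOp A → A 𝟙 ≗ 𝟘 → A (monoˢ (x ∷ [])) ≗ (- 1ℚ) ⊡ A (monoˢ (y ∷ []))
op-x {A} o A𝟙 u = trans (⊞-homo o (Rz 𝟙) ((- 1ℚ) ⊡ Ry 𝟙) u)
  (trans (cong₂ _+_ (trans (Rz-comm o 𝟙 u) (trans (Rz-cong A𝟙 u) (Rz-𝟘 u))) (⊡-homo o (- 1ℚ) (Ry 𝟙) u))
         (arith (A (Ry 𝟙) u)))
  where
  arith : ∀ a → 0ℚ + - 1ℚ * a ≡ - 1ℚ * a
  arith = solve-∀ ℚ-ring

-- The term -2 A(1) z drops out, and what is left is right multiplication by z + y = x + 2y, the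
-- factor in rule (II).
growth-𝟙 : ∀ {A} → A 𝟙 ≗ 𝟘 → growth A 𝟙 ≗ Rz ((A °) 𝟙) ⊞ Ry ((A °) 𝟙)
growth-𝟙 {A} A𝟙 u = trans (cong (λ a → Rz ((A °) 𝟙) u + Ry ((A °) 𝟙) u + -2ℚ * a) (trans (Rz-cong A𝟙 u) (Rz-𝟘 u)))
  (arith (Rz ((A °) 𝟙) u + Ry ((A °) 𝟙) u))
  where
  arith : ∀ a → a + -2ℚ * 0ℚ ≡ a
  arith = solve-∀ ℚ-ring

⊗-y : ∀ p → ⟦ p ⊗ mono (y ∷ []) ⟧ ≗ Ry ⟦ p ⟧
⊗-y p u = trans (⟦⟧-⊗ p (mono (y ∷ [])) u) (trans (⊛-cong {S = ⟦ p ⟧} (λ _ → refl) (⟦⟧-mono (y ∷ [])) u)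
  (trans (⊛-Ry ⟦ p ⟧ 𝟙 u) (Ry-cong (⊛-identityʳ ⟦ p ⟧) u)))

⊗-x+2y : ∀ p → ⟦ p ⊗ x+2y ⟧ ≗ Rz ⟦ p ⟧ ⊞ Ry ⟦ p ⟧
⊗-x+2y p u = trans (⟦⟧-⊗ p x+2y u)
  (trans (⊛-cong {S = ⟦ p ⟧} (λ _ → refl) (λ v → arith (Rz 𝟙 v) (Ry 𝟙 v)) u)
  (trans (⊛-⊞ʳ ⟦ p ⟧ (Rz 𝟙) (Ry 𝟙) u) (cong₂ _+_
    (trans (⊛-Rz ⟦ p ⟧ 𝟙 u) (Rz-cong (⊛-identityʳ ⟦ p ⟧) u))
    (trans (⊛-Ry ⟦ p ⟧ 𝟙 u) (Ry-cong (⊛-identityʳ ⟦ p ⟧) u)))))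
  where
  arith : ∀ a b → 1ℚ * (a + - 1ℚ * b) + ((1ℚ + 1ℚ) * b + 0ℚ) ≡ a + b
  arith = solve-∀ ℚ-ring

-‿involutive : ∀ a → - 1ℚ * (- 1ℚ * a) ≡ a
-‿involutive = solve-∀ ℚ-ring

∑-congᴬ : ∀ {I : Set} {is : List I} {f g : I → ℚ} → All (λ i → f i ≡ g i) is → ∑ is f ≡ ∑ is g
∑-congᴬ []       = refl
∑-congᴬ (e ∷ es) = cong₂ _+_ e (∑-congᴬ es)

module _ (ρ : Assign) (isRTM : IsRootedTreeMap ρ) where
  open IsRootedTreeMap isRTM

  private
    Agrees : Forest → Word → Set
    Agrees f w = ⟦ ρ f (reverse w) ⟧ ≗ T f (monoˢ w)

    -- Rule (IV) carries agreement from letters to words, by recursion on the word. The assumption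
    -- covers all forests with at most n vertices since rule (IV) for f involves every forest in
    -- Δ(f).
    words : ∀ n → (∀ f → ∣ f ∣ ≤ᴺ n → ∀ v → Agrees f (v ∷ [])) → ∀ f → ∣ f ∣ ≤ᴺ n → ∀ w → Agrees f w
    words n letters [] _ [] u = trans (⟦⟧-cong (ρ [] []) (mono []) (unit []) u) (⟦⟧-mono [] u)
    words n letters (t ∷ f) _ [] u = trans (⟦⟧-cong (ρ (t ∷ f) []) zeroP (const t f) u) (sym (T-𝟙 t f u))
    words n letters f ∣f∣≤n (v ∷ w) u = begin
      ⟦ ρ f (reverse (v ∷ w)) ⟧ u
        ≡⟨ cong (λ w′ → ⟦ ρ f w′ ⟧ u) (unfold-reverse v w) ⟩
      ⟦ ρ f (reverse w ++ v ∷ []) ⟧ u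
        ≡⟨ ⟦⟧-cong (ρ f (reverse w ++ v ∷ [])) (sumP (map (λ p → ρ (proj₁ p) (reverse w) ⊗ ρ (proj₂ p) (v ∷ [])) (ΔF f))) (ruleIV f (reverse w) v) u ⟩
      ⟦ sumP (map (λ p → ρ (proj₁ p) (reverse w) ⊗ ρ (proj₂ p) (v ∷ [])) (ΔF f)) ⟧ u
        ≡⟨ ⟦⟧-sumP (λ p → ρ (proj₁ p) (reverse w) ⊗ ρ (proj₂ p) (v ∷ [])) (ΔF f) u ⟩
      ∑ (ΔF f) (λ p → ⟦ ρ (proj₁ p) (reverse w) ⊗ ρ (proj₂ p) (v ∷ []) ⟧ u)
        ≡⟨ ∑-congᴬ (All.map (λ {p} (b₁ , b₂) → trans
             (⟦⟧-⊗ (ρ (proj₁ p) (reverse w)) (ρ (proj₂ p) (v ∷ [])) u)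
             (⊛-cong (words n letters (proj₁ p) (ℕ.≤-trans b₁ ∣f∣≤n) w)
                     (letters (proj₂ p) (ℕ.≤-trans b₂ ∣f∣≤n) v) u))
             (ΔF-bounded f)) ⟩
      ∑ (ΔF f) (λ p → (T (proj₁ p) (monoˢ w) ⊛ T (proj₂ p) (monoˢ (v ∷ []))) u)
        ≡⟨ sym (T-⊛ f (monoˢ w) (monoˢ (v ∷ [])) u) ⟩
      T f (monoˢ w ⊛ monoˢ (v ∷ [])) u
        ≡⟨ ≗-cong (T-isOp f) (λ u′ → sym (monoˢ-++ (v ∷ []) w u′)) u ⟩
      T f (monoˢ (v ∷ w)) u ∎
      where open ≡-Reasoning

    module _ (t : Tree) (g : Forest) (IH : ∀ v → Agrees (t ∷ g) (v ∷ [])) where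

      private
        A : Operator
        A = T (t ∷ g)
        oA : IsOp A
        oA = T-isOp (t ∷ g)
        q : Poly
        q = proj₁ (ruleII t g)

        -- Rule (II) only asserts that some q exists. Agreement on x, with `op-x`, forces q to be
        -- the negative of `(A °) 𝟙`.
        A°𝟙 : (A °) 𝟙 ≗ (- 1ℚ) ⊡ ⟦ q ⟧
        A°𝟙 u = trans (sym (-‿involutive ((A °) 𝟙 u))) (cong (- 1ℚ *_) (begin
          - 1ℚ * (A °) 𝟙 u                    ≡⟨ sym (op-x oA (T-𝟙 t g) (y ∷ u)) ⟩
          A (monoˢ (x ∷ [])) (y ∷ u)          ≡⟨ sym (IH x (y ∷ u)) ⟩
          ⟦ ρ (t ∷ g) (x ∷ []) ⟧ (y ∷ u)      ≡⟨ ⟦⟧-cong (ρ (t ∷ g) (x ∷ [])) (q ⊗ mono (y ∷ [])) (proj₁ (proj₂ (ruleII t g))) (y ∷ u) ⟩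
          ⟦ q ⊗ mono (y ∷ []) ⟧ (y ∷ u)       ≡⟨ ⊗-y q (y ∷ u) ⟩
          ⟦ q ⟧ u ∎))
          where
          open ≡-Reasoning

        growth-A : growth A 𝟙 ≗ (- 1ℚ) ⊡ (Rz ⟦ q ⟧ ⊞ Ry ⟦ q ⟧)
        growth-A u = trans (growth-𝟙 {A} (T-𝟙 t g) u) (trans
          (cong₂ _+_ (trans (Rz-cong A°𝟙 u) (Rz-⊡ (- 1ℚ) ⟦ q ⟧ u)) (trans (Ry-cong A°𝟙 u) (Ry-⊡ (- 1ℚ) ⟦ q ⟧ u)))
          (arith (Rz ⟦ q ⟧ u) (Ry ⟦ q ⟧ u)))
          where
          arith : ∀ a b → - 1ℚ * a + - 1ℚ * b ≡ - 1ℚ * (a + b)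
          arith = solve-∀ ℚ-ring

        rhs : ⟦ (q ⊗ x+2y) ⊗ mono (y ∷ []) ⟧ ≗ (- 1ℚ) ⊡ Ry (growth A 𝟙)
        rhs u = trans (⊗-y (q ⊗ x+2y) u) (trans (Ry-cong (⊗-x+2y q) u) (sym
          (trans (cong (- 1ℚ *_) (trans (Ry-cong growth-A u) (Ry-⊡ (- 1ℚ) _ u)))
                 (-‿involutive (Ry (Rz ⟦ q ⟧ ⊞ Ry ⟦ q ⟧) u)))))

      letters-B₊ : ∀ v → Agrees (B₊ (t ∷ g) ∷ []) (v ∷ [])
      letters-B₊ x u = begin
        ⟦ ρ (B₊ (t ∷ g) ∷ []) (x ∷ []) ⟧ u
          ≡⟨ ⟦⟧-cong (ρ (B₊ (t ∷ g) ∷ []) (x ∷ [])) ((q ⊗ x+2y) ⊗ mono (y ∷ [])) (proj₁ (proj₂ (proj₂ (ruleII t g)))) u ⟩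
        ⟦ (q ⊗ x+2y) ⊗ mono (y ∷ []) ⟧ u
          ≡⟨ rhs u ⟩
        - 1ℚ * Ry (growth A 𝟙) u
          ≡⟨ cong (- 1ℚ *_) (sym (graft-y oA u)) ⟩
        - 1ℚ * graft A (monoˢ (y ∷ [])) u
          ≡⟨ sym (op-x (graft-isOp oA) (graft-𝟙 oA) u) ⟩
        graft A (monoˢ (x ∷ [])) u ∎
        where open ≡-Reasoning
      letters-B₊ y u = begin
        ⟦ ρ (B₊ (t ∷ g) ∷ []) (y ∷ []) ⟧ u
          ≡⟨ ⟦⟧-cong (ρ (B₊ (t ∷ g) ∷ []) (y ∷ [])) (negP ((q ⊗ x+2y) ⊗ mono (y ∷ []))) (proj₂ (proj₂ (proj₂ (ruleII t g)))) u ⟩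
        ⟦ negP ((q ⊗ x+2y) ⊗ mono (y ∷ [])) ⟧ u
          ≡⟨ ⟦⟧-scale (- 1ℚ) ((q ⊗ x+2y) ⊗ mono (y ∷ [])) u ⟩
        - 1ℚ * ⟦ (q ⊗ x+2y) ⊗ mono (y ∷ []) ⟧ u
          ≡⟨ cong (- 1ℚ *_) (rhs u) ⟩
        - 1ℚ * (- 1ℚ * Ry (growth A 𝟙) u)
          ≡⟨ -‿involutive (Ry (growth A 𝟙) u) ⟩
        Ry (growth A 𝟙) u
          ≡⟨ sym (graft-y oA u) ⟩
        graft A (monoˢ (y ∷ [])) u ∎
        where open ≡-Reasoning

    letters-• : ∀ v → Agrees (• ∷ []) (v ∷ [])
    letters-• v u = trans (lhs v u) (sym (rhs v u))
      where
      xy : Series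
      xy = monoˢ (y ∷ x ∷ [])
      sign : Letter → ℚ
      sign x = 1ℚ
      sign y = - 1ℚ
      -- For the identity the term -2z survives and turns z + y into y - z = -x, which produces rule
      -- (I).
      growth-id : growth id 𝟙 ≗ (- 1ℚ) ⊡ monoˢ (x ∷ [])
      growth-id u = arith (Rz 𝟙 u) (Ry 𝟙 u)
        where
        arith : ∀ a b → a + b + -2ℚ * a ≡ - 1ℚ * (a + - 1ℚ * b)
        arith = solve-∀ ℚ-ring
      E-y : E (monoˢ (y ∷ [])) ≗ (- 1ℚ) ⊡ xy
      E-y u = trans (graft-y id-isOp u) (trans (Ry-cong growth-id u) (Ry-⊡ (- 1ℚ) (monoˢ (x ∷ [])) u))
      lhs : ∀ v → ⟦ ρ (• ∷ []) (v ∷ []) ⟧ ≗ sign v ⊡ xy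
      lhs x u = trans (⟦⟧-cong (ρ (• ∷ []) (x ∷ [])) (mono (x ∷ y ∷ [])) ruleIx u) (trans (⟦⟧-mono (x ∷ y ∷ []) u) (sym (*-identityˡ (xy u))))
      lhs y u = trans (⟦⟧-cong (ρ (• ∷ []) (y ∷ [])) (negP (mono (x ∷ y ∷ []))) ruleIy u) (trans (⟦⟧-scale (- 1ℚ) (mono (x ∷ y ∷ [])) u)
        (cong (- 1ℚ *_) (⟦⟧-mono (x ∷ y ∷ []) u)))
      rhs : ∀ v → E (monoˢ (v ∷ [])) ≗ sign v ⊡ xy
      rhs x u = trans (op-x (graft-isOp id-isOp) (graft-𝟙 id-isOp) u) (trans (cong (- 1ℚ *_) (E-y u))
        (trans (-‿involutive (xy u)) (sym (*-identityˡ (xy u)))))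
      rhs y u = E-y u

    lin-agrees : ∀ f → (∀ w → Agrees f w) → ∀ p → ⟦ lin ρ f p ⟧ ≗ T f ⟦ p ⟧
    lin-agrees f agrees p u = trans (⟦⟧-sumP (λ m → scale (proj₁ m) (ρ f (proj₂ m))) p u)
      (trans (∑-cong p λ m → trans (⟦⟧-scale (proj₁ m) (ρ f (proj₂ m)) u) (cong (proj₁ m *_)
        (trans (cong (λ w → ⟦ ρ f w ⟧ u) (sym (reverse-involutive (proj₂ m)))) (agrees (reverse (proj₂ m)) u))))
      (sym (∑-homo-* (T-isOp f) p proj₁ _ u)))

    -- Induction on a bound for the number of vertices. Single trees use rules (I) and (II); for a
    -- product, rule (III) needs the first tree on whole polynomials, which `words` supplies at the
    -- smaller bound.
    letters : ∀ n f → ∣ f ∣ ≤ᴺ n → ∀ v → Agrees f (v ∷ [])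
    letters n [] _ v u = trans (⟦⟧-cong (ρ [] (v ∷ [])) (mono (v ∷ [])) (unit (v ∷ [])) u) (⟦⟧-mono (v ∷ []) u)
    letters (suc n) (node [] ∷ []) _ = letters-•
    letters (suc n) (node (t ∷ g) ∷ []) (s≤s b) =
      letters-B₊ t g (letters n (t ∷ g) (ℕ.≤-trans (ℕ.m≤m+n _ 0) b))
    letters (suc n) (node h ∷ node h′ ∷ g) (s≤s b) v u = begin
      ⟦ ρ ((t ∷ []) ++ f) (v ∷ []) ⟧ u
        ≡⟨ ⟦⟧-cong (ρ ((t ∷ []) ++ f) (v ∷ [])) (lin ρ (t ∷ []) (ρ f (v ∷ []))) (ruleIII (t ∷ []) f v) u ⟩
      ⟦ lin ρ (t ∷ []) (ρ f (v ∷ [])) ⟧ u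
        ≡⟨ lin-agrees (t ∷ []) (words n (letters n) (t ∷ []) (ℕ.≤-trans ∣t∣≤ b)) (ρ f (v ∷ [])) u ⟩
      T (t ∷ []) ⟦ ρ f (v ∷ []) ⟧ u
        ≡⟨ ≗-cong (T-isOp (t ∷ [])) (letters n f (ℕ.≤-trans (ℕ.m≤n+m ∣ f ∣ ∣ h ∣) b) v) u ⟩
      T (t ∷ f) (monoˢ (v ∷ [])) u ∎
      where
      open ≡-Reasoning
      t = node h
      f = node h′ ∷ g
      -- The second tree has at least one vertex, which makes room for the root of the first.
      ∣t∣≤ : ∣ t ∷ [] ∣ ≤ᴺ ∣ h ∣ +ᴺ ∣ f ∣
      ∣t∣≤ = ℕ.≤-trans (ℕ.≤-reflexive (sym (ℕ.+-suc ∣ h ∣ 0))) (ℕ.+-monoʳ-≤ ∣ h ∣ (s≤s z≤n))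

  ρ≗T : ∀ f w → ⟦ ρ f w ⟧ ≗ T f (monoˢ (reverse w))
  ρ≗T f w u = trans (cong (λ w′ → ⟦ ρ f w′ ⟧ u) (sym (reverse-involutive w)))
    (words ∣ f ∣ (letters ∣ f ∣) f ℕ.≤-refl (reverse w) u)

  ρH≗TH : ∀ h w → ⟦ ρH ρ h w ⟧ ≗ TH h (monoˢ (reverse w))
  ρH≗TH h w u = trans (⟦⟧-sumP (λ a → scale (proj₁ a) (ρ (proj₂ a) w)) h u)
    (∑-cong h λ a → trans (⟦⟧-scale (proj₁ a) (ρ (proj₂ a) w) u) (cong (proj₁ a *_) (ρ≗T (proj₂ a) w u)))

  spans : Spans ρ
  spans h with spanned-TH h
  ... | us , inU , eq = us , inU , λ w → ⟦⟧-injective (ρH ρ h w) (ρH ρ us w) λ u →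
    trans (ρH≗TH h w u) (trans (eq _ u) (sym (ρH≗TH us w u)))

-- A vanishing result for the equation behind independence.

pos*≡0 : ∀ c {a} .{{_ : Positive c}} → c * a ≡ 0ℚ → a ≡ 0ℚ
pos*≡0 c {a} ca≡0 = begin
  a                ≡⟨ sym (*-identityˡ a) ⟩
  1ℚ * a           ≡⟨ cong (_* a) (sym (*-inverseˡ c)) ⟩
  1/ c * c * a     ≡⟨ *-assoc (1/ c) c a ⟩
  1/ c * (c * a)   ≡⟨ cong (1/ c *_) ca≡0 ⟩
  1/ c * 0ℚ        ≡⟨ *-zeroʳ (1/ c) ⟩
  0ℚ ∎
  where
  open ≡-Reasoning
  instance _ = pos⇒nonZero c

Vanishes : ℕ → Series → Set
Vanishes d S = ∀ u → length u ≡ d → S u ≡ 0ℚ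

-- E is homogeneous of degree one: `growth id` multiplies by y - z, and constants are sent to zero.
E-vanishes : ∀ d {S} → Vanishes d S → Vanishes (suc d) (E S)
E-vanishes zero    S≡0 (z ∷ [])         _ = refl
E-vanishes zero    S≡0 (y ∷ [])         _ = refl
E-vanishes (suc d) S≡0 (z ∷ u)          e = E-vanishes d (λ v e′ → S≡0 (z ∷ v) (cong suc e′)) u (ℕ.suc-injective e)
E-vanishes (suc d) {S} S≡0 (y ∷ u@(l ∷ v)) e = trans
  (cong (_+ growth id (∂ y S) u) (E-vanishes d (λ w e′ → S≡0 (y ∷ w) (cong suc e′)) u (ℕ.suc-injective e)))
  (tail l)
  where
  S≡0′ : ∂ y S v ≡ 0ℚ
  S≡0′ = S≡0 (y ∷ v) (ℕ.suc-injective e)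
  tail : ∀ l → 0ℚ + growth id (∂ y S) (l ∷ v) ≡ 0ℚ
  tail z = cong (λ s → 0ℚ + (s + 0ℚ + -2ℚ * s)) S≡0′
  tail y = cong (λ s → 0ℚ + (0ℚ + s + -2ℚ * 0ℚ)) S≡0′

-- If 2n Q = n E(Q_z) - E(Q_y y) y⁻¹, where Q = Q(0) + Q_z z + Q_y y, then
-- n Q_z - Q_y satisfies the same equation with 2n + 1 in place of n, and its
-- image under E determines Q_z and Q_y.
E-eigen : ∀ d n .{{_ : Positive n}} Q →
          (∀ u → (n + n) * Q u ≡ n * E (∂ z Q) u + - (E °) (∂ y Q) u) → Vanishes d Q
E-eigen zero n Q eq [] _ = pos*≡0 (n + n) {{pos+pos⇒pos n n}} (trans (eq []) (arith n))
  where
  arith : ∀ n → n * 0ℚ + - (0ℚ + (0ℚ + 0ℚ + -2ℚ * 0ℚ)) ≡ 0ℚ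
  arith = solve-∀ ℚ-ring
E-eigen (suc d) n Q eq (l ∷ u) e = result l
  where
  N : ℚ
  N = n + n + 1ℚ
  instance
    2n-pos : Positive (n + n)
    2n-pos = pos+pos⇒pos n n
    N-pos : Positive N
    N-pos = pos+pos⇒pos (n + n) 1ℚ
  oE = graft-isOp id-isOp
  Q′ : Series
  Q′ = n ⊡ ∂ z Q ⊞ (- 1ℚ) ⊡ ∂ y Q
  E-Q′ : ∀ v → E Q′ v ≡ n * E (∂ z Q) v + - 1ℚ * E (∂ y Q) v
  E-Q′ v = trans (⊞-homo oE (n ⊡ ∂ z Q) ((- 1ℚ) ⊡ ∂ y Q) v)
    (cong₂ _+_ (⊡-homo oE n (∂ z Q) v) (⊡-homo oE (- 1ℚ) (∂ y Q) v))
  -- Here E(Q_y y) y⁻¹ = E(Q_y) + Q_y (y - z). With its minus sign this adds Q_y at a last letter z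
  -- and subtracts it at y, and the latter turns the factor 2n into N.
  eq-z : ∀ v → (n + n) * Q (z ∷ v) ≡ E Q′ (z ∷ v) + Q (y ∷ v)
  eq-z v = trans (eq (z ∷ v)) (trans (arith n (E (∂ z Q) (z ∷ v)) (E (∂ y Q) (z ∷ v)) (Q (y ∷ v)))
    (cong (_+ Q (y ∷ v)) (sym (E-Q′ (z ∷ v)))))
    where
    arith : ∀ n a b q → n * a + - (b + (q + 0ℚ + -2ℚ * q)) ≡ n * a + - 1ℚ * b + q
    arith = solve-∀ ℚ-ring
  eq-y : ∀ v → N * Q (y ∷ v) ≡ E Q′ (y ∷ v)
  eq-y v = trans (arith n (Q (y ∷ v))) (trans (cong (_+ Q (y ∷ v)) (eq (y ∷ v)))
    (trans (arith′ n (E (∂ z Q) (y ∷ v)) (E (∂ y Q) (y ∷ v)) (Q (y ∷ v))) (sym (E-Q′ (y ∷ v)))))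
    where
    arith : ∀ n q → (n + n + 1ℚ) * q ≡ (n + n) * q + q
    arith = solve-∀ ℚ-ring
    arith′ : ∀ n a b q → n * a + - (b + (0ℚ + q + -2ℚ * 0ℚ)) + q ≡ n * a + - 1ℚ * b
    arith′ = solve-∀ ℚ-ring
  -- By definition `E Q′ (z ∷ v)` is `E (∂ z Q′) v` and `E Q′ (y ∷ v)` is `(E °) (∂ y Q′) v`. The
  -- combination N times `eq-z` minus `eq-y` cancels the extra Q_y.
  eq′ : ∀ v → (N + N) * Q′ v ≡ N * E (∂ z Q′) v + - (E °) (∂ y Q′) v
  eq′ v = trans (arith n (Q (z ∷ v)) (Q (y ∷ v)))
    (trans (cong₂ (λ a b → N * (a + - Q (y ∷ v)) + - b) (eq-z v) (eq-y v))
           (arith′ N (E Q′ (z ∷ v)) (Q (y ∷ v)) (E Q′ (y ∷ v))))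
    where
    arith : ∀ n a b → (n + n + 1ℚ + (n + n + 1ℚ)) * (n * a + - 1ℚ * b) ≡
                      (n + n + 1ℚ) * ((n + n) * a + - b) + - ((n + n + 1ℚ) * b)
    arith = solve-∀ ℚ-ring
    arith′ : ∀ N a q b → N * (a + q + - q) + - b ≡ N * a + - b
    arith′ = solve-∀ ℚ-ring
  E-Q′≡0 : ∀ l → E Q′ (l ∷ u) ≡ 0ℚ
  E-Q′≡0 l = E-vanishes d (E-eigen d N Q′ eq′) (l ∷ u) e
  Qy≡0 : Q (y ∷ u) ≡ 0ℚ
  Qy≡0 = pos*≡0 N (trans (eq-y u) (E-Q′≡0 y))
  result : ∀ l → Q (l ∷ u) ≡ 0ℚ
  result y = Qy≡0
  result z = pos*≡0 (n + n) (trans (eq-z u) (cong₂ _+_ (E-Q′≡0 z) Qy≡0))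

𝟙-E°-graft-independent : ∀ c S V → (c ⊡ 𝟙 ⊞ (E °) S) ⊞ (Rz V ⊞ Ry V) ≗ 𝟘 → c ≡ 0ℚ × S ≗ 𝟘 × V ≗ 𝟘
𝟙-E°-graft-independent c S V eq = trans (arith c) (eq []) , S≗𝟘 , V≗𝟘
  where
  arith : ∀ c → c ≡ c * 1ℚ + (0ℚ + (0ℚ + 0ℚ + -2ℚ * 0ℚ)) + (0ℚ + 0ℚ)
  arith = solve-∀ ℚ-ring
  S≗𝟘 : S ≗ 𝟘
  -- The coefficients at last letters z and y contain the same summand `V v`. Their difference is
  -- the equation of `E-eigen` with n = 1.
  S≗𝟘 u = E-eigen (length u) 1ℚ S (λ v → trans (arith₁ c (E S (z ∷ v)) (E S (y ∷ v)) (S v) (V v))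
    (trans (cong₂ (λ a b → 1ℚ * E (∂ z S) v + - E S (y ∷ v) + - (a + - b)) (eq (z ∷ v)) (eq (y ∷ v)))
           (arith₂ (E (∂ z S) v) (E S (y ∷ v))))) u refl
    where
    arith₁ : ∀ c a b s v → (1ℚ + 1ℚ) * s ≡
      1ℚ * a + - b + - ((c * 0ℚ + (a + (s + 0ℚ + -2ℚ * s)) + (v + 0ℚ)) + - (c * 0ℚ + (b + (0ℚ + s + -2ℚ * 0ℚ)) + (0ℚ + v)))
    arith₁ = solve-∀ ℚ-ring
    arith₂ : ∀ a b → 1ℚ * a + - b + - (0ℚ + - 0ℚ) ≡ 1ℚ * a + - b
    arith₂ = solve-∀ ℚ-ring
  E°S≗𝟘 : (E °) S ≗ 𝟘
  E°S≗𝟘 u = trans (graft-cong id-isOp (λ v → trans (Ry-cong S≗𝟘 v) (Ry-𝟘 v)) (y ∷ u)) (graft-𝟘 id-isOp (y ∷ u))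
  V≗𝟘 : V ≗ 𝟘
  V≗𝟘 u = trans (arith₁ c (V u)) (trans
    (cong (λ s → c * 0ℚ + s + (0ℚ + V u)) (sym (E°S≗𝟘 (y ∷ u))))
    (eq (y ∷ u)))
    where
    arith₁ : ∀ c v → v ≡ c * 0ℚ + 0ℚ + (0ℚ + v)
    arith₁ = solve-∀ ℚ-ring

-- Decomposition of relations in U and independence.

-- T f (y) = G f · y, and B₊ acts on G as right multiplication by z + y.
G : Forest → Series
G f = (T f °) 𝟙

GH : H → Series
GH us u = ∑ us (λ a → proj₁ a * G (proj₂ a) u)

G-• : ∀ f → G (• ∷ f) ≗ (E °) (G f)
G-• f u = sym (°-∘ (graft-isOp id-isOp) (T-isOp f) 𝟙 u)

G-B₊ : ∀ t g → G (B₊ (t ∷ g) ∷ []) ≗ Rz (G (t ∷ g)) ⊞ Ry (G (t ∷ g))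
G-B₊ t g u = trans (graft-°-𝟙 (T-isOp (t ∷ g)) u) (growth-𝟙 {T (t ∷ g)} (T-𝟙 t g) u)

-- The coefficient of the empty forest and the elements of the shapes • f and
-- B₊ f with f nonempty, with • and B₊ removed; other forests are not in U.
coeff-𝕀 : H → ℚ
coeff-𝕀 []                                = 0ℚ
coeff-𝕀 ((c , []) ∷ us)                   = c + coeff-𝕀 us
coeff-𝕀 ((c , _ ∷ _) ∷ us)                = coeff-𝕀 us

un-• : H → H
un-• []                             = []
un-• ((c , []) ∷ us)                = un-• us
un-• ((c , node [] ∷ f) ∷ us)       = (c , f) ∷ un-• us
un-• ((c , node (_ ∷ _) ∷ _) ∷ us)  = un-• us

un-B₊ : H → H
un-B₊ []                            = []
un-B₊ ((c , []) ∷ us)               = un-B₊ us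
un-B₊ ((c , node [] ∷ _) ∷ us)      = un-B₊ us
un-B₊ ((c , node (t ∷ g) ∷ _) ∷ us) = (c , t ∷ g) ∷ un-B₊ us

AllU : H → Set
AllU = All (InU ∘ proj₂)

un-•-AllU : ∀ {us} → AllU us → AllU (un-• us)
un-•-AllU []                      = []
un-•-AllU (u-nil ∷ ps)            = un-•-AllU ps
un-•-AllU (u-dot p ∷ ps)          = p ∷ un-•-AllU ps
-- B₊ 𝕀 and • 𝕀 are the same forest; it is counted among the forests starting with •.
un-•-AllU (u-B₊ {[]} p ∷ ps)      = u-nil ∷ un-•-AllU ps
un-•-AllU (u-B₊ {t ∷ g} p ∷ ps)   = un-•-AllU ps

un-B₊-AllU : ∀ {us} → AllU us → AllU (un-B₊ us)
un-B₊-AllU []                     = []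
un-B₊-AllU (u-nil ∷ ps)           = un-B₊-AllU ps
un-B₊-AllU (u-dot p ∷ ps)         = un-B₊-AllU ps
un-B₊-AllU (u-B₊ {[]} p ∷ ps)     = un-B₊-AllU ps
un-B₊-AllU (u-B₊ {t ∷ g} p ∷ ps)  = p ∷ un-B₊-AllU ps

-- The shape to which `𝟙-E°-graft-independent` applies: a constant, an image under `E °`, and a
-- right multiple of z + y.
reassemble : H → Series
reassemble us = (coeff-𝕀 us ⊡ 𝟙 ⊞ (E °) (GH (un-• us))) ⊞ (Rz (GH (un-B₊ us)) ⊞ Ry (GH (un-B₊ us)))

GH-split-• : ∀ c f us u → GH us u ≡ reassemble us u →
             GH ((c , • ∷ f) ∷ us) u ≡ reassemble ((c , • ∷ f) ∷ us) u
GH-split-• c f us u eq = trans (cong₂ (λ a b → c * a + b) (G-• f u) eq)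
  (trans (arith (c * (E °) (G f) u) (coeff-𝕀 us * 𝟙 u) ((E °) V u) (Rz (GH (un-B₊ us)) u + Ry (GH (un-B₊ us)) u))
  (cong (λ s → coeff-𝕀 us * 𝟙 u + s + (Rz (GH (un-B₊ us)) u + Ry (GH (un-B₊ us)) u))
    (sym (trans (°-⊞ oE (c ⊡ G f) V u) (cong (_+ (E °) V u) (°-⊡ oE c (G f) u))))))
  where
  oE = graft-isOp id-isOp
  V = GH (un-• us)
  arith : ∀ a k b d → a + (k + b + d) ≡ k + (a + b) + d
  arith = solve-∀ ℚ-ring

GH-split : ∀ {us} → AllU us → GH us ≗ reassemble us
GH-split [] u = sym (trans (cong₂ (λ a b → 0ℚ * 𝟙 u + a + b) E°𝟘 (cong₂ _+_ (Rz-𝟘 u) (Ry-𝟘 u))) (arith (𝟙 u)))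
  where
  E°𝟘 : (E °) 𝟘 u ≡ 0ℚ
  E°𝟘 = trans (graft-cong id-isOp Ry-𝟘 (y ∷ u)) (graft-𝟘 id-isOp (y ∷ u))
  arith : ∀ a → 0ℚ * a + 0ℚ + (0ℚ + 0ℚ) ≡ 0ℚ
  arith = solve-∀ ℚ-ring
GH-split {(c , _) ∷ us} (u-nil ∷ ps) u = trans (cong (c * 𝟙 u +_) (GH-split ps u))
  (arith c (coeff-𝕀 us) (𝟙 u) _ _)
  where
  arith : ∀ c k i a b → c * i + (k * i + a + b) ≡ (c + k) * i + a + b
  arith = solve-∀ ℚ-ring
GH-split {(c , _) ∷ us} (u-dot {f} p ∷ ps) u = GH-split-• c f us u (GH-split ps u)
GH-split {(c , _) ∷ us} (u-B₊ {[]} p ∷ ps) u = GH-split-• c [] us u (GH-split ps u)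
GH-split {(c , _) ∷ us} (u-B₊ {t ∷ g} p ∷ ps) u = trans (cong₂ (λ a b → c * a + b) (G-B₊ t g u) (GH-split ps u))
  (trans (arith c (Rz W u) (Ry W u) (coeff-𝕀 us * 𝟙 u + (E °) (GH (un-• us)) u) (Rz V u) (Ry V u))
         (sym (cong₂ (λ a b → coeff-𝕀 us * 𝟙 u + (E °) (GH (un-• us)) u + (a + b))
           (trans (Rz-⊞ (c ⊡ W) V u) (cong (_+ Rz V u) (Rz-⊡ c W u)))
           (trans (Ry-⊞ (c ⊡ W) V u) (cong (_+ Ry V u) (Ry-⊡ c W u))))))
  where
  W = G (t ∷ g)
  V = GH (un-B₊ us)
  arith : ∀ c a b d e f → c * (a + b) + (d + (e + f)) ≡ d + (c * a + e + (c * b + f))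
  arith = solve-∀ ℚ-ring

Distinct : H → Set
Distinct = AllPairs (λ a b → proj₂ a ≢ proj₂ b)

un-•-≢ : ∀ {f us} → All (λ b → • ∷ f ≢ proj₂ b) us → All (λ b → f ≢ proj₂ b) (un-• us)
un-•-≢ {us = []}                          []       = []
un-•-≢ {us = (_ , []) ∷ _}                (_ ∷ ns) = un-•-≢ ns
un-•-≢ {us = (_ , node [] ∷ _) ∷ _}       (n ∷ ns) = (n ∘ cong (• ∷_)) ∷ un-•-≢ ns
un-•-≢ {us = (_ , node (_ ∷ _) ∷ _) ∷ _}  (_ ∷ ns) = un-•-≢ ns

un-•-distinct : ∀ {us} → Distinct us → Distinct (un-• us)
un-•-distinct {[]}                         []       = []
un-•-distinct {(_ , []) ∷ _}               (_ ∷ ds) = un-•-distinct ds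
un-•-distinct {(_ , node [] ∷ _) ∷ _}      (n ∷ ds) = un-•-≢ n ∷ un-•-distinct ds
un-•-distinct {(_ , node (_ ∷ _) ∷ _) ∷ _} (_ ∷ ds) = un-•-distinct ds

-- `un-B₊` forgets the trees after the first. Membership in U ensures that there are none when the
-- first tree is B₊ of a nonempty forest, so distinctness survives.
un-B₊-≢ : ∀ {f us} → AllU us → All (λ b → B₊ f ∷ [] ≢ proj₂ b) us → All (λ b → f ≢ proj₂ b) (un-B₊ us)
un-B₊-≢ []                     []       = []
un-B₊-≢ (u-nil ∷ ps)           (_ ∷ ns) = un-B₊-≢ ps ns
un-B₊-≢ (u-dot _ ∷ ps)         (_ ∷ ns) = un-B₊-≢ ps ns
un-B₊-≢ (u-B₊ {[]} _ ∷ ps)     (_ ∷ ns) = un-B₊-≢ ps ns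
un-B₊-≢ (u-B₊ {_ ∷ _} _ ∷ ps)  (n ∷ ns) = (n ∘ cong (λ f → B₊ f ∷ [])) ∷ un-B₊-≢ ps ns

un-B₊-distinct : ∀ {us} → AllU us → Distinct us → Distinct (un-B₊ us)
un-B₊-distinct []                    []       = []
un-B₊-distinct (u-nil ∷ ps)          (_ ∷ ds) = un-B₊-distinct ps ds
un-B₊-distinct (u-dot _ ∷ ps)        (_ ∷ ds) = un-B₊-distinct ps ds
un-B₊-distinct (u-B₊ {[]} _ ∷ ps)    (_ ∷ ds) = un-B₊-distinct ps ds
un-B₊-distinct (u-B₊ {_ ∷ _} _ ∷ ps) (n ∷ ds) = un-B₊-≢ ps n ∷ un-B₊-distinct ps ds

coeff-𝕀-absent : ∀ {us} → All (λ b → [] ≢ proj₂ b) us → coeff-𝕀 us ≡ 0ℚ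
coeff-𝕀-absent {[]}               []       = refl
coeff-𝕀-absent {(_ , []) ∷ _}     (n ∷ _)  = contradiction refl n
coeff-𝕀-absent {(_ , _ ∷ _) ∷ _}  (_ ∷ ns) = coeff-𝕀-absent ns

coeff-𝕀-∈ : ∀ {us c} → Distinct us → (c , []) ∈ us → coeff-𝕀 us ≡ c
coeff-𝕀-∈ {_} {c} (n ∷ _) (here refl) = trans (cong (c +_) (coeff-𝕀-absent n)) (+-identityʳ c)
coeff-𝕀-∈ {(_ , []) ∷ _}    (n ∷ _)  (there i) = contradiction refl (All.lookup n i)
coeff-𝕀-∈ {(_ , _ ∷ _) ∷ _} (_ ∷ ds) (there i) = coeff-𝕀-∈ ds i

∈-un-• : ∀ {c f us} → (c , • ∷ f) ∈ us → (c , f) ∈ un-• us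
∈-un-• (here refl) = here refl
∈-un-• {us = (_ , []) ∷ _}               (there i) = ∈-un-• i
∈-un-• {us = (_ , node [] ∷ _) ∷ _}      (there i) = there (∈-un-• i)
∈-un-• {us = (_ , node (_ ∷ _) ∷ _) ∷ _} (there i) = ∈-un-• i

∈-un-B₊ : ∀ {c t g us} → (c , B₊ (t ∷ g) ∷ []) ∈ us → (c , t ∷ g) ∈ un-B₊ us
∈-un-B₊ (here refl) = here refl
∈-un-B₊ {us = (_ , []) ∷ _}               (there i) = ∈-un-B₊ i
∈-un-B₊ {us = (_ , node [] ∷ _) ∷ _}      (there i) = ∈-un-B₊ i
∈-un-B₊ {us = (_ , node (_ ∷ _) ∷ _) ∷ _} (there i) = there (∈-un-B₊ i)

-- Recursion on the derivation of `InU f`. The relation splits into three parts that vanish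
-- separately, and c is either the coefficient of 𝕀 or reappears in one of the other two parts as
-- the coefficient of f with • or B₊ removed.
GH-independent : ∀ {f} → InU f → ∀ {us c} → AllU us → Distinct us → GH us ≗ 𝟘 → (c , f) ∈ us → c ≡ 0ℚ
GH-independent {f} p {us} ps ds GH≗𝟘 i = go p i
  where
  parts : coeff-𝕀 us ≡ 0ℚ × GH (un-• us) ≗ 𝟘 × GH (un-B₊ us) ≗ 𝟘
  parts = 𝟙-E°-graft-independent (coeff-𝕀 us) (GH (un-• us)) (GH (un-B₊ us))
    (λ u → trans (sym (GH-split ps u)) (GH≗𝟘 u))
  go : ∀ {f c} → InU f → (c , f) ∈ us → c ≡ 0ℚ
  go u-nil             i = trans (sym (coeff-𝕀-∈ ds i)) (proj₁ parts)
  go (u-dot p)         i = GH-independent p (un-•-AllU ps) (un-•-distinct ds) (proj₁ (proj₂ parts)) (∈-un-• i)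
  go (u-B₊ {[]} p)     i = GH-independent p (un-•-AllU ps) (un-•-distinct ds) (proj₁ (proj₂ parts)) (∈-un-• i)
  go (u-B₊ {_ ∷ _} p)  i = GH-independent p (un-B₊-AllU ps) (un-B₊-distinct ps ds) (proj₂ (proj₂ parts)) (∈-un-B₊ i)

independent : (ρ : Assign) → IsRootedTreeMap ρ → Independent ρ
independent ρ isRTM us inU distinct ρus≐0 = All.tabulate λ {a} a∈us →
  GH-independent (All.lookup inU a∈us) inU
    -- Equal forests have equal maps, so distinct maps come from distinct forests.
    (AllPairs.map (λ ρf≢ρg f≡g → ρf≢ρg (λ w w′ → cong (λ f → coeff (ρ f w) w′) f≡g)) distinct)
    -- The relation is used only at the word y, where cancelling the last letter y of the values
    -- leaves the series `GH us`.
    (λ u → trans (sym (ρH≗TH ρ isRTM us (y ∷ []) (y ∷ u)))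
                 (⟦⟧-cong (ρH ρ us (y ∷ [])) zeroP (ρus≐0 (y ∷ [])) (y ∷ u)))
    a∈us

theorem3p1 : (ρ : Assign) → IsRootedTreeMap ρ → Spans ρ × Independent ρ
theorem3p1 ρ isRTM = spans ρ isRTM , independent ρ isRTM
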